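{- The following identities hold: \begin{align*}\sum_{k=1}^\infty\frac{77k^2-53k+10}{k(3k-1)(3k-2)(-2)^k\binom{4k}k}&=-3\log2, \\\sum_{k=1}^\infty\frac{415k^2-343k+62}{k(3k-1)(3k-2)(-8)^k\binom{4k}k}&=-3\log2, \\\sum_{k=1}^\infty\frac{187k^2-131k+22}{k(3k-1)(3k-2)(-24)^k\binom{4k}k}&=\log\frac23, \\\sum_{k=1}^\infty\frac{1261k^2-989k+170}{k(3k-1)(3k-2)(-192)^k\binom{4k}k}&=\log\frac34. \end{align*} -}

module Defs where

open import Data.Nat.Base as ℕ using (ℕ; zero; suc)
import Data.Nat.Properties as ℕ
import Data.Nat.DivMod as ℕ
import Data.Nat.Divisibility as ℕ
open import Data.Nat.Combinatorics using (_C_; k![n∸k]!∣n!)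
open import Data.Nat.Combinatorics.Specification using (nCk≡n!/k![n-k]!)
open import Data.Integer.Base as ℤ using (ℤ; +_; -[1+_]; +[1+_]; +0)
import Data.Integer.Properties as ℤ
open import Data.Rational.Base as ℚ
  using (ℚ; mkℚ; 0ℚ; 1ℚ; _/_; Positive; toℚᵘ)
import Data.Rational.Properties as ℚ
import Data.Rational.Unnormalised.Base as ℚᵘ
import Data.Rational.Unnormalised.Properties as ℚᵘ
open import Data.Rational.Solver using (module +-*-Solver)
open import Data.Product.Base using (∃-syntax; _×_; _,_; proj₁; proj₂)
open import Data.Sum.Base using (inj₁; inj₂)
open import Function.Base using (it)
open import Relation.Binary.PropositionalEquality

IsCauchy : (ℕ → ℚ) → Set
IsCauchy s = ∀ ε → 0ℚ ℚ.< ε →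
  ∃[ N ] (∀ m n → N ℕ.≤ m → N ℕ.≤ n → ℚ.∣ s m ℚ.- s n ∣ ℚ.< ε)

record ℝ : Set where
  constructor mkℝ
  field
    seq    : ℕ → ℚ
    cauchy : IsCauchy seq

open ℝ public

module CauchyLemmas where

  half-pos : ∀ {ε} → 0ℚ ℚ.< ε → 0ℚ ℚ.< ℚ.½ ℚ.* ε
  half-pos {ε} 0<ε =
    subst (ℚ._< ℚ.½ ℚ.* ε) (ℚ.*-zeroʳ ℚ.½) (ℚ.*-monoʳ-<-pos ℚ.½ 0<ε)

  half+half : ∀ ε → ℚ.½ ℚ.* ε ℚ.+ ℚ.½ ℚ.* ε ≡ ε
  half+half ε = trans (sym (ℚ.*-distribʳ-+ ε ℚ.½ ℚ.½)) (ℚ.*-identityˡ ε)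

  const-cauchy : ∀ q → IsCauchy (λ _ → q)
  const-cauchy q ε 0<ε = 0 , λ _ _ _ _ →
    subst (ℚ._< ε) (sym (cong ℚ.∣_∣ (ℚ.+-inverseʳ q))) 0<ε

  rearrange : ∀ a b c d →
    (a ℚ.+ b) ℚ.- (c ℚ.+ d) ≡ (a ℚ.- c) ℚ.+ (b ℚ.- d)
  rearrange = +-*-Solver.solve 4
    (λ a b c d → (a :+ b) :+ (:- (c :+ d)) := (a :+ (:- c)) :+ (b :+ (:- d))) refl
    where open +-*-Solver

  +-cauchy : ∀ s t → IsCauchy s → IsCauchy t → IsCauchy (λ n → s n ℚ.+ t n)
  +-cauchy s t cs ct ε 0<ε =
    N₁ ℕ.⊔ N₂ , λ m n N≤m N≤n → begin-strict
      ℚ.∣ (s m ℚ.+ t m) ℚ.- (s n ℚ.+ t n) ∣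
        ≡⟨ cong ℚ.∣_∣ (rearrange (s m) (t m) (s n) (t n)) ⟩
      ℚ.∣ (s m ℚ.- s n) ℚ.+ (t m ℚ.- t n) ∣
        ≤⟨ ℚ.∣p+q∣≤∣p∣+∣q∣ (s m ℚ.- s n) (t m ℚ.- t n) ⟩
      ℚ.∣ s m ℚ.- s n ∣ ℚ.+ ℚ.∣ t m ℚ.- t n ∣
        <⟨ ℚ.+-mono-<
             (p₁ m n (ℕ.m⊔n≤o⇒m≤o N₁ N₂ N≤m) (ℕ.m⊔n≤o⇒m≤o N₁ N₂ N≤n))
             (p₂ m n (ℕ.m⊔n≤o⇒n≤o N₁ N₂ N≤m) (ℕ.m⊔n≤o⇒n≤o N₁ N₂ N≤n)) ⟩
      ℚ.½ ℚ.* ε ℚ.+ ℚ.½ ℚ.* ε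
        ≡⟨ half+half ε ⟩
      ε ∎
    where
    open ℚ.≤-Reasoning
    N₁ = proj₁ (cs (ℚ.½ ℚ.* ε) (half-pos 0<ε))
    p₁ = proj₂ (cs (ℚ.½ ℚ.* ε) (half-pos 0<ε))
    N₂ = proj₁ (ct (ℚ.½ ℚ.* ε) (half-pos 0<ε))
    p₂ = proj₂ (ct (ℚ.½ ℚ.* ε) (half-pos 0<ε))

  scale-cauchy : ∀ c s → IsCauchy s → IsCauchy (λ n → c ℚ.* s n)
  scale-cauchy c s cs ε 0<ε = N , λ m n N≤m N≤n → begin-strict
      ℚ.∣ c ℚ.* s m ℚ.- c ℚ.* s n ∣
        ≡⟨ cong ℚ.∣_∣ (factor c (s m) (s n)) ⟩
      ℚ.∣ c ℚ.* (s m ℚ.- s n) ∣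
        ≡⟨ ℚ.∣p*q∣≡∣p∣*∣q∣ c (s m ℚ.- s n) ⟩
      ℚ.∣ c ∣ ℚ.* ℚ.∣ s m ℚ.- s n ∣
        ≤⟨ ℚ.*-monoʳ-≤-nonNeg ℚ.∣ s m ℚ.- s n ∣
             {{ℚ.∣-∣-nonNeg (s m ℚ.- s n)}} ∣c∣≤k ⟩
      k ℚ.* ℚ.∣ s m ℚ.- s n ∣
        <⟨ ℚ.*-monoʳ-<-pos k (p m n N≤m N≤n) ⟩
      k ℚ.* δ
        ≡⟨ ℚ.*-assoc k (ℚ.1/ k) ε ⟨
      (k ℚ.* ℚ.1/ k) ℚ.* ε
        ≡⟨ cong (ℚ._* ε) (ℚ.*-inverseʳ k) ⟩
      1ℚ ℚ.* ε
        ≡⟨ ℚ.*-identityˡ ε ⟩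
      ε ∎
    where
    open ℚ.≤-Reasoning
    k = 1ℚ ℚ.+ ℚ.∣ c ∣
    instance
      k>0 : Positive k
      k>0 = ℚ.pos+nonNeg⇒pos 1ℚ ℚ.∣ c ∣ {{ℚ.∣-∣-nonNeg c}}
      k≢0 : ℚ.NonZero k
      k≢0 = ℚ.pos⇒nonZero k
    ∣c∣≤k : ℚ.∣ c ∣ ℚ.≤ k
    ∣c∣≤k = subst (ℚ._≤ k) (ℚ.+-identityˡ ℚ.∣ c ∣)
              (ℚ.+-monoˡ-≤ ℚ.∣ c ∣ (ℚ.nonNegative⁻¹ 1ℚ))
    δ = ℚ.1/ k ℚ.* ε
    0<δ : 0ℚ ℚ.< δ
    0<δ = subst (ℚ._< δ) (ℚ.*-zeroʳ (ℚ.1/ k))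
            (ℚ.*-monoʳ-<-pos (ℚ.1/ k) {{ℚ.1/pos⇒pos k}} 0<ε)
    N = proj₁ (cs δ 0<δ)
    p = proj₂ (cs δ 0<δ)
    factor : ∀ c a b → c ℚ.* a ℚ.- c ℚ.* b ≡ c ℚ.* (a ℚ.- b)
    factor = +-*-Solver.solve 3
      (λ c a b → (c :* a) :+ (:- (c :* b)) := c :* (a :+ (:- b))) refl
      where open +-*-Solver

  ∣a∣-∣b∣≤∣a-b∣ : ∀ a b → ℚ.∣ a ∣ ℚ.- ℚ.∣ b ∣ ℚ.≤ ℚ.∣ a ℚ.- b ∣
  ∣a∣-∣b∣≤∣a-b∣ a b = begin
      ℚ.∣ a ∣ ℚ.- ℚ.∣ b ∣
        ≡⟨ cong (λ z → ℚ.∣ z ∣ ℚ.- ℚ.∣ b ∣) (split a b) ⟩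
      ℚ.∣ (a ℚ.- b) ℚ.+ b ∣ ℚ.- ℚ.∣ b ∣
        ≤⟨ ℚ.+-monoˡ-≤ (ℚ.- ℚ.∣ b ∣) (ℚ.∣p+q∣≤∣p∣+∣q∣ (a ℚ.- b) b) ⟩
      (ℚ.∣ a ℚ.- b ∣ ℚ.+ ℚ.∣ b ∣) ℚ.- ℚ.∣ b ∣
        ≡⟨ cancel ℚ.∣ a ℚ.- b ∣ ℚ.∣ b ∣ ⟩
      ℚ.∣ a ℚ.- b ∣ ∎
    where
    open ℚ.≤-Reasoning
    split : ∀ a b → a ≡ (a ℚ.- b) ℚ.+ b
    split = +-*-Solver.solve 2 (λ a b → a := (a :+ (:- b)) :+ b) refl
      where open +-*-Solver
    cancel : ∀ x y → (x ℚ.+ y) ℚ.- y ≡ x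
    cancel = +-*-Solver.solve 2 (λ x y → (x :+ y) :+ (:- y) := x) refl
      where open +-*-Solver

  swap-diff : ∀ a b → ℚ.- (a ℚ.- b) ≡ b ℚ.- a
  swap-diff = +-*-Solver.solve 2 (λ a b → :- (a :+ (:- b)) := b :+ (:- a)) refl
    where open +-*-Solver

  ∣a-b∣≡∣b-a∣ : ∀ a b → ℚ.∣ a ℚ.- b ∣ ≡ ℚ.∣ b ℚ.- a ∣
  ∣a-b∣≡∣b-a∣ a b =
    trans (sym (ℚ.∣-p∣≡∣p∣ (a ℚ.- b))) (cong ℚ.∣_∣ (swap-diff a b))

  ∣∣a∣-∣b∣∣≤∣a-b∣ : ∀ a b → ℚ.∣ ℚ.∣ a ∣ ℚ.- ℚ.∣ b ∣ ∣ ℚ.≤ ℚ.∣ a ℚ.- b ∣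
  ∣∣a∣-∣b∣∣≤∣a-b∣ a b with ℚ.∣p∣≡p∨∣p∣≡-p (ℚ.∣ a ∣ ℚ.- ℚ.∣ b ∣)
  ... | inj₁ eq = subst (ℚ._≤ ℚ.∣ a ℚ.- b ∣) (sym eq) (∣a∣-∣b∣≤∣a-b∣ a b)
  ... | inj₂ eq = subst₂ ℚ._≤_ (sym (trans eq (swap-diff ℚ.∣ a ∣ ℚ.∣ b ∣)))
                    (∣a-b∣≡∣b-a∣ b a) (∣a∣-∣b∣≤∣a-b∣ b a)

  abs-cauchy : ∀ s → IsCauchy s → IsCauchy (λ n → ℚ.∣ s n ∣)
  abs-cauchy s cs ε 0<ε = proj₁ (cs ε 0<ε) , λ m n N≤m N≤n →
    ℚ.≤-<-trans (∣∣a∣-∣b∣∣≤∣a-b∣ (s m) (s n)) (proj₂ (cs ε 0<ε) m n N≤m N≤n)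

  neg-cauchy : ∀ s → IsCauchy s → IsCauchy (λ n → ℚ.- s n)
  neg-cauchy s cs ε 0<ε = proj₁ (cs ε 0<ε) , λ m n N≤m N≤n →
    subst (ℚ._< ε)
      (trans (∣a-b∣≡∣b-a∣ (s m) (s n)) (cong ℚ.∣_∣ (neg-diff (s m) (s n))))
      (proj₂ (cs ε 0<ε) m n N≤m N≤n)
    where
    neg-diff : ∀ a b → b ℚ.- a ≡ (ℚ.- a) ℚ.- (ℚ.- b)
    neg-diff = +-*-Solver.solve 2
      (λ a b → b :+ (:- a) := (:- a) :+ (:- (:- b))) refl
      where open +-*-Solver

open CauchyLemmas

fromℚ : ℚ → ℝ
fromℚ q = mkℝ (λ _ → q) (const-cauchy q)

infix  8 -_
infixl 6 _+_ _-_
infixr 7 _·_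
infix  4 _<_

_+_ : ℝ → ℝ → ℝ
x + y = mkℝ (λ n → seq x n ℚ.+ seq y n) (+-cauchy (seq x) (seq y) (cauchy x) (cauchy y))

-_ : ℝ → ℝ
- x = mkℝ (λ n → ℚ.- seq x n) (neg-cauchy (seq x) (cauchy x))

_·_ : ℚ → ℝ → ℝ
c · x = mkℝ (λ n → c ℚ.* seq x n) (scale-cauchy c (seq x) (cauchy x))

_-_ : ℝ → ℝ → ℝ
x - y = x + - y

∣_∣ : ℝ → ℝ
∣ x ∣ = mkℝ (λ n → ℚ.∣ seq x n ∣) (abs-cauchy (seq x) (cauchy x))

-- Constructively, x < y carries a rational gap δ separating the tails.
_<_ : ℝ → ℝ → Set
x < y = ∃[ δ ] (0ℚ ℚ.< δ × ∃[ N ] (∀ n → N ℕ.≤ n → seq x n ℚ.+ δ ℚ.≤ seq y n))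

_⟶_ : (ℕ → ℝ) → ℝ → Set
s ⟶ x = ∀ ε → 0ℚ ℚ.< ε → ∃[ N ] (∀ n → N ℕ.≤ n → ∣ s n - x ∣ < fromℚ ε)

-- Series start at k = 1, so terms need not be defined at k = 0.
Terms : Set
Terms = (k : ℕ) → .{{ℕ.NonZero k}} → ℚ

partialSum : Terms → ℕ → ℝ
partialSum a zero    = fromℚ 0ℚ
partialSum a (suc n) = partialSum a n + fromℚ (a (suc n))

infix 3 ∑∞_≐_

∑∞_≐_ : Terms → ℝ → Set
∑∞ a ≐ S = partialSum a ⟶ S

∑ : ℕ → (ℕ → ℚ) → ℚ
∑ zero    f = 0ℚ
∑ (suc n) f = ∑ n f ℚ.+ f n

fromℕ : ℕ → ℚ
fromℕ n = + n / 1

-- The left Riemann sum for ∫ₐᵇ f over n equal subintervals.  The step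
-- (b - a) / n is negative when b < a, so the integral is oriented.
step : ℚ → ℚ → (n : ℕ) → .{{ℕ.NonZero n}} → ℚ
step a b n = (b ℚ.- a) ℚ.* (+ 1 / n)

riemannSum : (ℚ → ℚ) → ℚ → ℚ → (n : ℕ) → .{{ℕ.NonZero n}} → ℚ
riemannSum f a b n =
  ∑ n (λ i → f (a ℚ.+ fromℕ i ℚ.* step a b n) ℚ.* step a b n)

-- t lies between a and b, in either order.
Segment : ℚ → ℚ → ℚ → Set
Segment a b t =
  ∃[ r ] (0ℚ ℚ.≤ r × r ℚ.≤ 1ℚ × t ≡ a ℚ.+ r ℚ.* (b ℚ.- a))

LipschitzOn : ℚ → ℚ → (ℚ → ℚ) → Set
LipschitzOn a b f = ∃[ K ] (0ℚ ℚ.≤ K ×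
  (∀ t u → Segment a b t → Segment a b u →
     ℚ.∣ f t ℚ.- f u ∣ ℚ.≤ K ℚ.* ℚ.∣ t ℚ.- u ∣))

module RiemannLemmas where

  0≤fromℕ : ∀ n → 0ℚ ℚ.≤ fromℕ n
  0≤fromℕ n = ℚ.nonNegative⁻¹ (fromℕ n) {{ℚ.normalize-nonNeg n 1}}

  fromℕ-+ : ∀ m n → fromℕ (m ℕ.+ n) ≡ fromℕ m ℚ.+ fromℕ n
  fromℕ-+ m n = ℚ.toℚᵘ-injective (begin
      toℚᵘ (fromℕ (m ℕ.+ n))
        ≈⟨ ℚ.toℚᵘ-fromℚᵘ (ℚᵘ.mkℚᵘ (+ (m ℕ.+ n)) 0) ⟩
      ℚᵘ.mkℚᵘ (+ (m ℕ.+ n)) 0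
        ≈⟨ ℚᵘ.*≡* (cong (ℤ._* + 1) (sym
             (cong₂ ℤ._+_ (ℤ.*-identityʳ (+ m)) (ℤ.*-identityʳ (+ n))))) ⟩
      ℚᵘ.mkℚᵘ (+ m) 0 ℚᵘ.+ ℚᵘ.mkℚᵘ (+ n) 0
        ≈⟨ ℚᵘ.+-cong (ℚ.toℚᵘ-fromℚᵘ (ℚᵘ.mkℚᵘ (+ m) 0))
                     (ℚ.toℚᵘ-fromℚᵘ (ℚᵘ.mkℚᵘ (+ n) 0)) ⟨
      toℚᵘ (fromℕ m) ℚᵘ.+ toℚᵘ (fromℕ n)
        ≈⟨ ℚ.toℚᵘ-homo-+ (fromℕ m) (fromℕ n) ⟨
      toℚᵘ (fromℕ m ℚ.+ fromℕ n) ∎)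
    where open ℚᵘ.≃-Reasoning

  fromℕ-* : ∀ m n → fromℕ (m ℕ.* n) ≡ fromℕ m ℚ.* fromℕ n
  fromℕ-* m n = ℚ.toℚᵘ-injective (begin
      toℚᵘ (fromℕ (m ℕ.* n))
        ≈⟨ ℚ.toℚᵘ-fromℚᵘ (ℚᵘ.mkℚᵘ (+ (m ℕ.* n)) 0) ⟩
      ℚᵘ.mkℚᵘ (+ (m ℕ.* n)) 0
        ≈⟨ ℚᵘ.*≡* (cong (ℤ._* + 1) (ℤ.pos-* m n)) ⟩
      ℚᵘ.mkℚᵘ (+ m) 0 ℚᵘ.* ℚᵘ.mkℚᵘ (+ n) 0
        ≈⟨ ℚᵘ.*-cong (ℚ.toℚᵘ-fromℚᵘ (ℚᵘ.mkℚᵘ (+ m) 0))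
                     (ℚ.toℚᵘ-fromℚᵘ (ℚᵘ.mkℚᵘ (+ n) 0)) ⟨
      toℚᵘ (fromℕ m) ℚᵘ.* toℚᵘ (fromℕ n)
        ≈⟨ ℚ.toℚᵘ-homo-* (fromℕ m) (fromℕ n) ⟨
      toℚᵘ (fromℕ m ℚ.* fromℕ n) ∎)
    where open ℚᵘ.≃-Reasoning

  fromℕ-mono : ∀ {m n} → m ℕ.≤ n → fromℕ m ℚ.≤ fromℕ n
  fromℕ-mono {m} {n} m≤n = begin
      fromℕ m                       ≡⟨ ℚ.+-identityʳ (fromℕ m) ⟨
      fromℕ m ℚ.+ 0ℚ                ≤⟨ ℚ.+-monoʳ-≤ (fromℕ m) (0≤fromℕ (n ℕ.∸ m)) ⟩
      fromℕ m ℚ.+ fromℕ (n ℕ.∸ m)   ≡⟨ fromℕ-+ m (n ℕ.∸ m) ⟨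
      fromℕ (m ℕ.+ (n ℕ.∸ m))       ≡⟨ cong fromℕ (ℕ.m+[n∸m]≡n m≤n) ⟩
      fromℕ n                       ∎
    where open ℚ.≤-Reasoning

  fromℕ-inverse : ∀ n .{{_ : ℕ.NonZero n}} → fromℕ n ℚ.* (+ 1 / n) ≡ 1ℚ
  fromℕ-inverse (suc n) = ℚ.toℚᵘ-injective (begin
      toℚᵘ (fromℕ (suc n) ℚ.* (+ 1 / suc n))
        ≈⟨ ℚ.toℚᵘ-homo-* (fromℕ (suc n)) (+ 1 / suc n) ⟩
      toℚᵘ (fromℕ (suc n)) ℚᵘ.* toℚᵘ (+ 1 / suc n)
        ≈⟨ ℚᵘ.*-cong (ℚ.toℚᵘ-fromℚᵘ (ℚᵘ.mkℚᵘ (+ suc n) 0))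
                     (ℚ.toℚᵘ-fromℚᵘ (ℚᵘ.mkℚᵘ (+ 1) n)) ⟩
      ℚᵘ.mkℚᵘ (+ suc n) 0 ℚᵘ.* ℚᵘ.mkℚᵘ (+ 1) n
        ≈⟨ ℚᵘ.*≡* (trans (ℤ.*-identityʳ (+ suc n ℤ.* + 1))
             (trans (ℤ.*-identityʳ (+ suc n))
               (sym (trans (ℤ.*-identityˡ (+ (1 ℕ.* suc n)))
                 (cong +_ (ℕ.*-identityˡ (suc n))))))) ⟩
      ℚᵘ.1ℚᵘ ∎)
    where open ℚᵘ.≃-Reasoning

  0<1/n : ∀ n .{{_ : ℕ.NonZero n}} → Positive (+ 1 / n)
  0<1/n n = ℚ.normalize-pos 1 n

  1/n-refine : ∀ n m .{{_ : ℕ.NonZero n}} .{{_ : ℕ.NonZero m}}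
    .{{_ : ℕ.NonZero (n ℕ.* m)}} → fromℕ m ℚ.* (+ 1 / (n ℕ.* m)) ≡ + 1 / n
  1/n-refine n m = begin
      fromℕ m ℚ.* (+ 1 / (n ℕ.* m))
        ≡⟨ ℚ.*-identityˡ _ ⟨
      1ℚ ℚ.* (fromℕ m ℚ.* (+ 1 / (n ℕ.* m)))
        ≡⟨ cong (ℚ._* (fromℕ m ℚ.* (+ 1 / (n ℕ.* m)))) (fromℕ-inverse n) ⟨
      (fromℕ n ℚ.* (+ 1 / n)) ℚ.* (fromℕ m ℚ.* (+ 1 / (n ℕ.* m)))
        ≡⟨ regroup (fromℕ n) (+ 1 / n) (fromℕ m) (+ 1 / (n ℕ.* m)) ⟩
      ((fromℕ n ℚ.* fromℕ m) ℚ.* (+ 1 / (n ℕ.* m))) ℚ.* (+ 1 / n)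
        ≡⟨ cong (λ z → (z ℚ.* (+ 1 / (n ℕ.* m))) ℚ.* (+ 1 / n)) (fromℕ-* n m) ⟨
      (fromℕ (n ℕ.* m) ℚ.* (+ 1 / (n ℕ.* m))) ℚ.* (+ 1 / n)
        ≡⟨ cong (ℚ._* (+ 1 / n)) (fromℕ-inverse (n ℕ.* m)) ⟩
      1ℚ ℚ.* (+ 1 / n)
        ≡⟨ ℚ.*-identityˡ _ ⟩
      + 1 / n ∎
    where
    open ≡-Reasoning
    regroup : ∀ a b c d → (a ℚ.* b) ℚ.* (c ℚ.* d) ≡ ((a ℚ.* c) ℚ.* d) ℚ.* b
    regroup = +-*-Solver.solve 4
      (λ a b c d → (a :* b) :* (c :* d) := ((a :* c) :* d) :* b) refl
      where open +-*-Solver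

  *-mono-nonNeg : ∀ {p q r s} → 0ℚ ℚ.≤ q → 0ℚ ℚ.≤ r →
    p ℚ.≤ q → r ℚ.≤ s → p ℚ.* r ℚ.≤ q ℚ.* s
  *-mono-nonNeg {p} {q} {r} {s} 0≤q 0≤r p≤q r≤s = ℚ.≤-trans
    (ℚ.*-monoʳ-≤-nonNeg r {{ℚ.nonNegative 0≤r}} p≤q)
    (ℚ.*-monoˡ-≤-nonNeg q {{ℚ.nonNegative 0≤q}} r≤s)

  *-nonNeg : ∀ {p q} → 0ℚ ℚ.≤ p → 0ℚ ℚ.≤ q → 0ℚ ℚ.≤ p ℚ.* q
  *-nonNeg {p} {q} 0≤p 0≤q = subst (ℚ._≤ p ℚ.* q) (ℚ.*-zeroʳ p)
    (ℚ.*-monoˡ-≤-nonNeg p {{ℚ.nonNegative 0≤p}} 0≤q)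

  archimedean : ∀ q → ∃[ N ] (∀ n → N ℕ.≤ n → q ℚ.< fromℕ (suc n))
  archimedean q = ℤ.∣ ℚ.↥ q ∣ , λ n N≤n → ℚ.≤-<-trans (q≤ q)
    (ℚ.≤-<-trans (fromℕ-mono N≤n) (n<1+n n))
    where
    n<1+n : ∀ n → fromℕ n ℚ.< fromℕ (suc n)
    n<1+n n = subst₂ ℚ._<_ (ℚ.+-identityˡ (fromℕ n)) (sym (fromℕ-+ 1 n))
      (ℚ.+-monoˡ-< (fromℕ n) (ℚ.positive⁻¹ 1ℚ))
    bound : ∀ i d → i ℤ.* + 1 ℤ.≤ + ℤ.∣ i ∣ ℤ.* + suc d
    bound (+ n)    d = subst₂ ℤ._≤_ (sym (ℤ.*-identityʳ (+ n))) (ℤ.pos-* n (suc d))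
                         (ℤ.+≤+ (ℕ.m≤m*n n (suc d)))
    bound -[1+ n ] d = ℤ.-≤+
    q≤ : ∀ q → q ℚ.≤ fromℕ ℤ.∣ ℚ.↥ q ∣
    q≤ q@(mkℚ i d _) = ℚ.toℚᵘ-cancel-≤ (ℚᵘ.≤-respʳ-≃
      (ℚᵘ.≃-sym (ℚ.toℚᵘ-fromℚᵘ (ℚᵘ.mkℚᵘ (+ ℤ.∣ i ∣) 0)))
      (ℚᵘ.*≤* (bound i d)))

  eventually-small : ∀ M ε → 0ℚ ℚ.< ε →
    ∃[ N ] (∀ n → N ℕ.≤ n → M ℚ.* (+ 1 / suc n) ℚ.< ε)
  eventually-small M ε 0<ε = proj₁ arch , λ n N≤n → begin-strict
      M ℚ.* (+ 1 / suc n)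
        ≡⟨ cong (ℚ._* (+ 1 / suc n)) M≡q*ε ⟩
      (q ℚ.* ε) ℚ.* (+ 1 / suc n)
        <⟨ ℚ.*-monoˡ-<-pos (+ 1 / suc n) {{0<1/n (suc n)}}
             (ℚ.*-monoˡ-<-pos ε (proj₂ arch n N≤n)) ⟩
      (fromℕ (suc n) ℚ.* ε) ℚ.* (+ 1 / suc n)
        ≡⟨ regroup (fromℕ (suc n)) ε (+ 1 / suc n) ⟩
      (fromℕ (suc n) ℚ.* (+ 1 / suc n)) ℚ.* ε
        ≡⟨ cong (ℚ._* ε) (fromℕ-inverse (suc n)) ⟩
      1ℚ ℚ.* ε
        ≡⟨ ℚ.*-identityˡ ε ⟩
      ε ∎
    where
    open ℚ.≤-Reasoning
    instance
      ε>0 : Positive ε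
      ε>0 = ℚ.positive 0<ε
      ε≢0 : ℚ.NonZero ε
      ε≢0 = ℚ.pos⇒nonZero ε
    q = M ℚ.÷ ε
    arch = archimedean q
    M≡q*ε : M ≡ q ℚ.* ε
    M≡q*ε = sym (trans (ℚ.*-assoc M (ℚ.1/ ε) ε)
      (trans (cong (M ℚ.*_) (ℚ.*-inverseˡ ε)) (ℚ.*-identityʳ M)))
    regroup : ∀ a b c → (a ℚ.* b) ℚ.* c ≡ (a ℚ.* c) ℚ.* b
    regroup = +-*-Solver.solve 3
      (λ a b c → (a :* b) :* c := (a :* c) :* b) refl
      where open +-*-Solver

  ∑-cong : ∀ n {f g} → (∀ i → f i ≡ g i) → ∑ n f ≡ ∑ n g
  ∑-cong zero    eq = refl
  ∑-cong (suc n) eq = cong₂ ℚ._+_ (∑-cong n eq) (eq n)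

  ∑-split : ∀ m n f → ∑ (m ℕ.+ n) f ≡ ∑ m f ℚ.+ ∑ n (λ j → f (m ℕ.+ j))
  ∑-split m zero f rewrite ℕ.+-identityʳ m = sym (ℚ.+-identityʳ (∑ m f))
  ∑-split m (suc n) f rewrite ℕ.+-suc m n =
    trans (cong (ℚ._+ f (m ℕ.+ n)) (∑-split m n f))
          (ℚ.+-assoc (∑ m f) (∑ n (λ j → f (m ℕ.+ j))) (f (m ℕ.+ n)))

  ∑-nest : ∀ n m f → ∑ (n ℕ.* m) f ≡ ∑ n (λ i → ∑ m (λ j → f (i ℕ.* m ℕ.+ j)))
  ∑-nest zero    m f = refl
  ∑-nest (suc n) m f rewrite ℕ.+-comm m (n ℕ.* m) =
    trans (∑-split (n ℕ.* m) m f) 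
      (cong (ℚ._+ ∑ m (λ j → f (n ℕ.* m ℕ.+ j))) (∑-nest n m f))

  fromℕ-suc-* : ∀ n c → fromℕ (suc n) ℚ.* c ≡ fromℕ n ℚ.* c ℚ.+ c
  fromℕ-suc-* n c = trans (cong (ℚ._* c) (trans (cong fromℕ (ℕ.+-comm 1 n)) (fromℕ-+ n 1)))
    (trans (ℚ.*-distribʳ-+ c (fromℕ n) 1ℚ)
      (cong (fromℕ n ℚ.* c ℚ.+_) (ℚ.*-identityˡ c)))

  ∑-const : ∀ n c → ∑ n (λ _ → c) ≡ fromℕ n ℚ.* c
  ∑-const zero    c = sym (ℚ.*-zeroˡ c)
  ∑-const (suc n) c = trans (cong (ℚ._+ c) (∑-const n c)) (sym (fromℕ-suc-* n c))

  ∑-close : ∀ n f g B → (∀ i → i ℕ.< n → ℚ.∣ f i ℚ.- g i ∣ ℚ.≤ B) →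
    ℚ.∣ ∑ n f ℚ.- ∑ n g ∣ ℚ.≤ fromℕ n ℚ.* B
  ∑-close zero    f g B close = ℚ.≤-reflexive (sym (ℚ.*-zeroˡ B))
  ∑-close (suc n) f g B close = begin
      ℚ.∣ (∑ n f ℚ.+ f n) ℚ.- (∑ n g ℚ.+ g n) ∣
        ≡⟨ cong ℚ.∣_∣ (rearrange (∑ n f) (f n) (∑ n g) (g n)) ⟩
      ℚ.∣ (∑ n f ℚ.- ∑ n g) ℚ.+ (f n ℚ.- g n) ∣
        ≤⟨ ℚ.∣p+q∣≤∣p∣+∣q∣ (∑ n f ℚ.- ∑ n g) (f n ℚ.- g n) ⟩
      ℚ.∣ ∑ n f ℚ.- ∑ n g ∣ ℚ.+ ℚ.∣ f n ℚ.- g n ∣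
        ≤⟨ ℚ.+-mono-≤ (∑-close n f g B (λ i i<n → close i (ℕ.m≤n⇒m≤1+n i<n)))
                      (close n ℕ.≤-refl) ⟩
      fromℕ n ℚ.* B ℚ.+ B
        ≡⟨ fromℕ-suc-* n B ⟨
      fromℕ (suc n) ℚ.* B ∎
    where open ℚ.≤-Reasoning

  node-in-segment : ∀ a b n .{{_ : ℕ.NonZero n}} i → i ℕ.≤ n →
    Segment a b (a ℚ.+ fromℕ i ℚ.* step a b n)
  node-in-segment a b n i i≤n =
    fromℕ i ℚ.* (+ 1 / n) ,
    *-nonNeg (0≤fromℕ i) 0≤1/n ,
    subst (fromℕ i ℚ.* (+ 1 / n) ℚ.≤_) (fromℕ-inverse n)
      (ℚ.*-monoʳ-≤-nonNeg (+ 1 / n) {{ℚ.nonNegative 0≤1/n}} (fromℕ-mono i≤n)) ,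
    cong (a ℚ.+_) (regroup (fromℕ i) (b ℚ.- a) (+ 1 / n))
    where
    0≤1/n : 0ℚ ℚ.≤ + 1 / n
    0≤1/n = ℚ.<⇒≤ (ℚ.positive⁻¹ (+ 1 / n) {{0<1/n n}})
    regroup : ∀ a b c → a ℚ.* (b ℚ.* c) ≡ (a ℚ.* c) ℚ.* b
    regroup = +-*-Solver.solve 3
      (λ a b c → a :* (b :* c) := (a :* c) :* b) refl
      where open +-*-Solver

  module _ (f : ℚ → ℚ) (a b : ℚ) (lip : LipschitzOn a b f) where

    private
      K = proj₁ lip

    error : ℚ
    error = K ℚ.* (ℚ.∣ b ℚ.- a ∣ ℚ.* ℚ.∣ b ℚ.- a ∣)

    -- Passing to a refinement with n * m subintervals moves the Riemann sum
    -- by at most K (b - a)² / n.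
    refine : ∀ n m .{{_ : ℕ.NonZero n}} .{{_ : ℕ.NonZero m}}
      .{{_ : ℕ.NonZero (n ℕ.* m)}} →
      ℚ.∣ riemannSum f a b n ℚ.- riemannSum f a b (n ℕ.* m) ∣
        ℚ.≤ error ℚ.* (+ 1 / n)
    refine n m = begin
        ℚ.∣ riemannSum f a b n ℚ.- riemannSum f a b (n ℕ.* m) ∣
          ≡⟨ cong₂ (λ x y → ℚ.∣ x ℚ.- y ∣)
               (∑-cong n coarse) (∑-nest n m (λ k → f (u k) ℚ.* h′)) ⟩
        ℚ.∣ ∑ n (λ i → ∑ m (λ _ → f (t i) ℚ.* h′)) ℚ.-
            ∑ n (λ i → ∑ m (λ j → f (u (i ℕ.* m ℕ.+ j)) ℚ.* h′)) ∣
          ≤⟨ ∑-close n _ _ (fromℕ m ℚ.* B) (λ i i<n →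
               ∑-close m _ _ B (λ j j<m → cell i j i<n j<m)) ⟩
        fromℕ n ℚ.* (fromℕ m ℚ.* B)
          ≡⟨ regroup (fromℕ n) (fromℕ m) K ℚ.∣ h ∣ ℚ.∣ h′ ∣ ⟩
        (K ℚ.* ℚ.∣ h ∣) ℚ.* (fromℕ n ℚ.* (fromℕ m ℚ.* ℚ.∣ h′ ∣))
          ≡⟨ cong (λ z → (K ℚ.* ℚ.∣ h ∣) ℚ.* (fromℕ n ℚ.* z)) ∣h∣≡m∣h′∣ ⟨
        (K ℚ.* ℚ.∣ h ∣) ℚ.* (fromℕ n ℚ.* ℚ.∣ h ∣)
          ≡⟨ cong (λ z → (K ℚ.* z) ℚ.* (fromℕ n ℚ.* z)) ∣h∣≡D/n ⟩
        (K ℚ.* (D ℚ.* (+ 1 / n))) ℚ.* (fromℕ n ℚ.* (D ℚ.* (+ 1 / n)))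
          ≡⟨ regroup′ K D (+ 1 / n) (fromℕ n) ⟩
        (error ℚ.* (+ 1 / n)) ℚ.* (fromℕ n ℚ.* (+ 1 / n))
          ≡⟨ cong ((error ℚ.* (+ 1 / n)) ℚ.*_) (fromℕ-inverse n) ⟩
        (error ℚ.* (+ 1 / n)) ℚ.* 1ℚ
          ≡⟨ ℚ.*-identityʳ _ ⟩
        error ℚ.* (+ 1 / n) ∎
      where
      open ℚ.≤-Reasoning
      D = ℚ.∣ b ℚ.- a ∣
      h = step a b n
      h′ = step a b (n ℕ.* m)
      t : ℕ → ℚ
      t i = a ℚ.+ fromℕ i ℚ.* h
      u : ℕ → ℚ
      u k = a ℚ.+ fromℕ k ℚ.* h′
      B = (K ℚ.* ℚ.∣ h ∣) ℚ.* ℚ.∣ h′ ∣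

      swap : ∀ x y z → x ℚ.* (y ℚ.* z) ≡ y ℚ.* (x ℚ.* z)
      swap = +-*-Solver.solve 3
        (λ x y z → x :* (y :* z) := y :* (x :* z)) refl
        where open +-*-Solver

      regroup : ∀ n m k x y →
        n ℚ.* (m ℚ.* ((k ℚ.* x) ℚ.* y)) ≡ (k ℚ.* x) ℚ.* (n ℚ.* (m ℚ.* y))
      regroup = +-*-Solver.solve 5
        (λ n m k x y →
          n :* (m :* ((k :* x) :* y)) := (k :* x) :* (n :* (m :* y))) refl
        where open +-*-Solver

      regroup′ : ∀ k d r n →
        (k ℚ.* (d ℚ.* r)) ℚ.* (n ℚ.* (d ℚ.* r)) ≡
        ((k ℚ.* (d ℚ.* d)) ℚ.* r) ℚ.* (n ℚ.* r)
      regroup′ = +-*-Solver.solve 4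
        (λ k d r n →
          (k :* (d :* r)) :* (n :* (d :* r)) :=
          ((k :* (d :* d)) :* r) :* (n :* r)) refl
        where open +-*-Solver

      h≡mh′ : h ≡ fromℕ m ℚ.* h′
      h≡mh′ = trans (cong ((b ℚ.- a) ℚ.*_) (sym (1/n-refine n m)))
                (swap (b ℚ.- a) (fromℕ m) (+ 1 / (n ℕ.* m)))

      ∣m*x∣ : ∀ m x → ℚ.∣ fromℕ m ℚ.* x ∣ ≡ fromℕ m ℚ.* ℚ.∣ x ∣
      ∣m*x∣ m x = trans (ℚ.∣p*q∣≡∣p∣*∣q∣ (fromℕ m) x)
        (cong (ℚ._* ℚ.∣ x ∣) (ℚ.0≤p⇒∣p∣≡p (0≤fromℕ m)))

      ∣h∣≡m∣h′∣ : ℚ.∣ h ∣ ≡ fromℕ m ℚ.* ℚ.∣ h′ ∣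
      ∣h∣≡m∣h′∣ = trans (cong ℚ.∣_∣ h≡mh′) (∣m*x∣ m h′)

      ∣h∣≡D/n : ℚ.∣ h ∣ ≡ D ℚ.* (+ 1 / n)
      ∣h∣≡D/n = trans (ℚ.∣p*q∣≡∣p∣*∣q∣ (b ℚ.- a) (+ 1 / n))
        (cong (D ℚ.*_) (ℚ.0≤p⇒∣p∣≡p
          (ℚ.<⇒≤ (ℚ.positive⁻¹ (+ 1 / n) {{0<1/n n}}))))

      coarse : ∀ i → f (t i) ℚ.* h ≡ ∑ m (λ _ → f (t i) ℚ.* h′)
      coarse i = trans (cong (f (t i) ℚ.*_) h≡mh′)
        (trans (swap (f (t i)) (fromℕ m) h′) (sym (∑-const m (f (t i) ℚ.* h′))))

      offset : ∀ i j → t i ℚ.- u (i ℕ.* m ℕ.+ j) ≡ ℚ.- (fromℕ j ℚ.* h′)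
      offset i j = trans
        (cong₂ (λ x y → (a ℚ.+ fromℕ i ℚ.* x) ℚ.- (a ℚ.+ y ℚ.* h′)) h≡mh′
          (trans (fromℕ-+ (i ℕ.* m) j) (cong (ℚ._+ fromℕ j) (fromℕ-* i m))))
        (simplify a (fromℕ i) (fromℕ m) (fromℕ j) h′)
        where
        simplify : ∀ a i m j h →
          (a ℚ.+ i ℚ.* (m ℚ.* h)) ℚ.- (a ℚ.+ (i ℚ.* m ℚ.+ j) ℚ.* h) ≡
          ℚ.- (j ℚ.* h)
        simplify = +-*-Solver.solve 5
          (λ a i m j h →
            (a :+ i :* (m :* h)) :+ (:- (a :+ (i :* m :+ j) :* h)) :=
            :- (j :* h)) refl
          where open +-*-Solver

      ∣t-u∣≤∣h∣ : ∀ i j → j ℕ.< m → ℚ.∣ t i ℚ.- u (i ℕ.* m ℕ.+ j) ∣ ℚ.≤ ℚ.∣ h ∣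
      ∣t-u∣≤∣h∣ i j j<m = begin
        ℚ.∣ t i ℚ.- u (i ℕ.* m ℕ.+ j) ∣  ≡⟨ cong ℚ.∣_∣ (offset i j) ⟩
        ℚ.∣ ℚ.- (fromℕ j ℚ.* h′) ∣       ≡⟨ ℚ.∣-p∣≡∣p∣ (fromℕ j ℚ.* h′) ⟩
        ℚ.∣ fromℕ j ℚ.* h′ ∣             ≡⟨ ∣m*x∣ j h′ ⟩
        fromℕ j ℚ.* ℚ.∣ h′ ∣
          ≤⟨ ℚ.*-monoʳ-≤-nonNeg ℚ.∣ h′ ∣ {{ℚ.∣-∣-nonNeg h′}}
               (fromℕ-mono (ℕ.<⇒≤ j<m)) ⟩
        fromℕ m ℚ.* ℚ.∣ h′ ∣             ≡⟨ ∣h∣≡m∣h′∣ ⟨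
        ℚ.∣ h ∣                          ∎

      index-bound : ∀ i j → i ℕ.< n → j ℕ.< m → i ℕ.* m ℕ.+ j ℕ.≤ n ℕ.* m
      index-bound i j i<n j<m = ℕ.≤-trans (ℕ.+-monoʳ-≤ (i ℕ.* m) (ℕ.<⇒≤ j<m))
        (subst (ℕ._≤ n ℕ.* m) (ℕ.+-comm m (i ℕ.* m)) (ℕ.*-monoˡ-≤ m i<n))

      cell : ∀ i j → i ℕ.< n → j ℕ.< m →
        ℚ.∣ f (t i) ℚ.* h′ ℚ.- f (u (i ℕ.* m ℕ.+ j)) ℚ.* h′ ∣ ℚ.≤ B
      cell i j i<n j<m = begin
          ℚ.∣ f (t i) ℚ.* h′ ℚ.- f (u k) ℚ.* h′ ∣
            ≡⟨ cong ℚ.∣_∣ (factor (f (t i)) (f (u k)) h′) ⟩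
          ℚ.∣ (f (t i) ℚ.- f (u k)) ℚ.* h′ ∣
            ≡⟨ ℚ.∣p*q∣≡∣p∣*∣q∣ (f (t i) ℚ.- f (u k)) h′ ⟩
          ℚ.∣ f (t i) ℚ.- f (u k) ∣ ℚ.* ℚ.∣ h′ ∣
            ≤⟨ ℚ.*-monoʳ-≤-nonNeg ℚ.∣ h′ ∣ {{ℚ.∣-∣-nonNeg h′}}
                 (ℚ.≤-trans
                   (proj₂ (proj₂ lip) (t i) (u k)
                     (node-in-segment a b n i (ℕ.<⇒≤ i<n))
                     (node-in-segment a b (n ℕ.* m) k (index-bound i j i<n j<m)))
                   (ℚ.*-monoˡ-≤-nonNeg K {{ℚ.nonNegative (proj₁ (proj₂ lip))}}
                     (∣t-u∣≤∣h∣ i j j<m))) ⟩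
          B ∎
        where
        k = i ℕ.* m ℕ.+ j
        factor : ∀ x y z → x ℚ.* z ℚ.- y ℚ.* z ≡ (x ℚ.- y) ℚ.* z
        factor = +-*-Solver.solve 3
          (λ x y z → (x :* z) :+ (:- (y :* z)) := (x :+ (:- y)) :* z) refl
          where open +-*-Solver

    riemann-cauchy : IsCauchy (λ n → riemannSum f a b (suc n))
    riemann-cauchy ε 0<ε = proj₁ small , λ m n N≤m N≤n → begin-strict
        ℚ.∣ R (suc m) ℚ.- R (suc n) ∣
          ≡⟨ cong ℚ.∣_∣ (insert (R (suc m)) (R (suc m ℕ.* suc n)) (R (suc n))) ⟩
        ℚ.∣ (R (suc m) ℚ.- R (suc m ℕ.* suc n)) ℚ.+
            (R (suc m ℕ.* suc n) ℚ.- R (suc n)) ∣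
          ≤⟨ ℚ.∣p+q∣≤∣p∣+∣q∣ (R (suc m) ℚ.- R (suc m ℕ.* suc n))
                             (R (suc m ℕ.* suc n) ℚ.- R (suc n)) ⟩
        ℚ.∣ R (suc m) ℚ.- R (suc m ℕ.* suc n) ∣ ℚ.+
        ℚ.∣ R (suc m ℕ.* suc n) ℚ.- R (suc n) ∣
          ≡⟨ cong (ℚ.∣ R (suc m) ℚ.- R (suc m ℕ.* suc n) ∣ ℚ.+_)
               (trans (∣a-b∣≡∣b-a∣ (R (suc m ℕ.* suc n)) (R (suc n)))
                 (cong (λ z → ℚ.∣ R (suc n) ℚ.- z ∣)
                   (R-cong (ℕ.*-comm (suc m) (suc n))))) ⟩
        ℚ.∣ R (suc m) ℚ.- R (suc m ℕ.* suc n) ∣ ℚ.+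
        ℚ.∣ R (suc n) ℚ.- R (suc n ℕ.* suc m) ∣
          ≤⟨ ℚ.+-mono-≤ (refine (suc m) (suc n)) (refine (suc n) (suc m)) ⟩
        error ℚ.* (+ 1 / suc m) ℚ.+ error ℚ.* (+ 1 / suc n)
          <⟨ ℚ.+-mono-< (proj₂ small m N≤m) (proj₂ small n N≤n) ⟩
        ℚ.½ ℚ.* ε ℚ.+ ℚ.½ ℚ.* ε
          ≡⟨ half+half ε ⟩
        ε ∎
      where
      open ℚ.≤-Reasoning
      small = eventually-small error (ℚ.½ ℚ.* ε) (half-pos 0<ε)
      R : (n : ℕ) → .{{ℕ.NonZero n}} → ℚ
      R n = riemannSum f a b n
      R-cong : ∀ {m n} .{{_ : ℕ.NonZero m}} .{{_ : ℕ.NonZero n}} → m ≡ n → R m ≡ R n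
      R-cong refl = refl
      insert : ∀ x y z → x ℚ.- z ≡ (x ℚ.- y) ℚ.+ (y ℚ.- z)
      insert = +-*-Solver.solve 3
        (λ x y z → x :+ (:- z) := (x :+ (:- y)) :+ (y :+ (:- z))) refl
        where open +-*-Solver

open RiemannLemmas

-- The n-th approximation uses n + 1 subintervals.
integral : (f : ℚ → ℚ) (a b : ℚ) → LipschitzOn a b f → ℝ
integral f a b lip =
  mkℝ (λ n → riemannSum f a b (suc n)) (riemann-cauchy f a b lip)

-- The value at 0 is a dummy: log only samples recip at positive points.
recip : ℚ → ℚ
recip   (mkℚ +0       _ _) = 0ℚ
recip t@(mkℚ +[1+ _ ] _ _) = ℚ.1/ t
recip t@(mkℚ -[1+ _ ] _ _) = ℚ.1/ t

module RecipLemmas where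

  *-recip : ∀ t → 0ℚ ℚ.< t → t ℚ.* recip t ≡ 1ℚ
  *-recip t@(mkℚ +[1+ _ ] _ _) _   = ℚ.*-inverseʳ t
  *-recip t@(mkℚ -[1+ _ ] _ _) _   = ℚ.*-inverseʳ t
  *-recip t@(mkℚ +0       _ _) 0<t with () ← ℚ.positive 0<t

  recip-nonNeg : ∀ t → 0ℚ ℚ.< t → 0ℚ ℚ.≤ recip t
  recip-nonNeg t@(mkℚ +[1+ _ ] _ _) _   =
    ℚ.<⇒≤ (ℚ.positive⁻¹ (ℚ.1/ t) {{ℚ.1/pos⇒pos t}})
  recip-nonNeg t@(mkℚ -[1+ _ ] _ _) 0<t with () ← ℚ.positive 0<t
  recip-nonNeg t@(mkℚ +0       _ _) 0<t with () ← ℚ.positive 0<t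

  recip-antitone : ∀ c t → 0ℚ ℚ.< c → c ℚ.≤ t → recip t ℚ.≤ recip c
  recip-antitone c t 0<c c≤t = begin
      recip t
        ≡⟨ trans (sym (ℚ.*-identityˡ _)) (cong (ℚ._* recip t) (sym (*-recip c 0<c))) ⟩
      (c ℚ.* recip c) ℚ.* recip t
        ≤⟨ ℚ.*-monoʳ-≤-nonNeg (recip t) {{ℚ.nonNegative (recip-nonNeg t 0<t)}}
             (ℚ.*-monoʳ-≤-nonNeg (recip c) {{ℚ.nonNegative (recip-nonNeg c 0<c)}} c≤t) ⟩
      (t ℚ.* recip c) ℚ.* recip t
        ≡⟨ regroup t (recip c) (recip t) ⟩
      (t ℚ.* recip t) ℚ.* recip c
        ≡⟨ trans (cong (ℚ._* recip c) (*-recip t 0<t)) (ℚ.*-identityˡ _) ⟩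
      recip c ∎
    where
    open ℚ.≤-Reasoning
    0<t = ℚ.<-≤-trans 0<c c≤t
    regroup : ∀ a b c → (a ℚ.* b) ℚ.* c ≡ (a ℚ.* c) ℚ.* b
    regroup = +-*-Solver.solve 3
      (λ a b c → (a :* b) :* c := (a :* c) :* b) refl
      where open +-*-Solver

  segment-≥-min : ∀ x t → Segment 1ℚ x t → 1ℚ ℚ.⊓ x ℚ.≤ t
  segment-≥-min x t (r , 0≤r , r≤1 , refl) = begin
      c
        ≡⟨ convex r c ⟩
      (1ℚ ℚ.- r) ℚ.* c ℚ.+ r ℚ.* c
        ≤⟨ ℚ.+-mono-≤
             (ℚ.*-monoˡ-≤-nonNeg (1ℚ ℚ.- r) {{ℚ.nonNegative 0≤1-r}} (ℚ.p⊓q≤p 1ℚ x))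
             (ℚ.*-monoˡ-≤-nonNeg r {{ℚ.nonNegative 0≤r}} (ℚ.p⊓q≤q 1ℚ x)) ⟩
      (1ℚ ℚ.- r) ℚ.* 1ℚ ℚ.+ r ℚ.* x
        ≡⟨ expand r x ⟩
      1ℚ ℚ.+ r ℚ.* (x ℚ.- 1ℚ) ∎
    where
    open ℚ.≤-Reasoning
    c = 1ℚ ℚ.⊓ x
    0≤1-r : 0ℚ ℚ.≤ 1ℚ ℚ.- r
    0≤1-r = subst (ℚ._≤ 1ℚ ℚ.- r) (ℚ.+-inverseʳ r) (ℚ.+-monoˡ-≤ (ℚ.- r) r≤1)
    convex : ∀ r c → c ≡ (1ℚ ℚ.- r) ℚ.* c ℚ.+ r ℚ.* c
    convex = +-*-Solver.solve 2
      (λ r c → c := (con 1ℚ :+ (:- r)) :* c :+ r :* c) refl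
      where open +-*-Solver
    expand : ∀ r x → (1ℚ ℚ.- r) ℚ.* 1ℚ ℚ.+ r ℚ.* x ≡ 1ℚ ℚ.+ r ℚ.* (x ℚ.- 1ℚ)
    expand = +-*-Solver.solve 2
      (λ r x → (con 1ℚ :+ (:- r)) :* con 1ℚ :+ r :* x :=
               con 1ℚ :+ r :* (x :+ (:- con 1ℚ))) refl
      where open +-*-Solver

  min-pos : ∀ x → 0ℚ ℚ.< x → 0ℚ ℚ.< 1ℚ ℚ.⊓ x
  min-pos x 0<x with ℚ.⊓-sel 1ℚ x
  ... | inj₁ eq = subst (0ℚ ℚ.<_) (sym eq) (ℚ.positive⁻¹ 1ℚ)
  ... | inj₂ eq = subst (0ℚ ℚ.<_) (sym eq) 0<x

  recip-lipschitz : ∀ x → .{{_ : Positive x}} → LipschitzOn 1ℚ x recip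
  recip-lipschitz x =
    recip c ℚ.* recip c , *-nonNeg (recip-nonNeg c 0<c) (recip-nonNeg c 0<c) , bound
    where
    c = 1ℚ ℚ.⊓ x
    0<c = min-pos x (ℚ.positive⁻¹ x)
    difference : ∀ t u r s → t ℚ.* r ≡ 1ℚ → u ℚ.* s ≡ 1ℚ →
      r ℚ.- s ≡ (r ℚ.* s) ℚ.* (u ℚ.- t)
    difference t u r s tr≡1 us≡1 = begin
        r ℚ.- s
          ≡⟨ cong₂ ℚ._-_ (sym (ℚ.*-identityˡ r)) (sym (ℚ.*-identityˡ s)) ⟩
        1ℚ ℚ.* r ℚ.- 1ℚ ℚ.* s
          ≡⟨ cong₂ (λ p q → p ℚ.* r ℚ.- q ℚ.* s) us≡1 tr≡1 ⟨
        (u ℚ.* s) ℚ.* r ℚ.- (t ℚ.* r) ℚ.* s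
          ≡⟨ factor t u r s ⟩
        (r ℚ.* s) ℚ.* (u ℚ.- t) ∎
      where
      open ≡-Reasoning
      factor : ∀ t u r s →
        (u ℚ.* s) ℚ.* r ℚ.- (t ℚ.* r) ℚ.* s ≡ (r ℚ.* s) ℚ.* (u ℚ.- t)
      factor = +-*-Solver.solve 4
        (λ t u r s → (u :* s) :* r :+ (:- ((t :* r) :* s)) :=
                     (r :* s) :* (u :+ (:- t))) refl
        where open +-*-Solver
    bound : ∀ t u → Segment 1ℚ x t → Segment 1ℚ x u →
      ℚ.∣ recip t ℚ.- recip u ∣ ℚ.≤ (recip c ℚ.* recip c) ℚ.* ℚ.∣ t ℚ.- u ∣
    bound t u seg-t seg-u = begin
        ℚ.∣ recip t ℚ.- recip u ∣
          ≡⟨ cong ℚ.∣_∣ (difference t u (recip t) (recip u)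
               (*-recip t 0<t) (*-recip u 0<u)) ⟩
        ℚ.∣ (recip t ℚ.* recip u) ℚ.* (u ℚ.- t) ∣
          ≡⟨ ℚ.∣p*q∣≡∣p∣*∣q∣ (recip t ℚ.* recip u) (u ℚ.- t) ⟩
        ℚ.∣ recip t ℚ.* recip u ∣ ℚ.* ℚ.∣ u ℚ.- t ∣
          ≡⟨ cong₂ ℚ._*_
               (ℚ.0≤p⇒∣p∣≡p (*-nonNeg (recip-nonNeg t 0<t) (recip-nonNeg u 0<u)))
               (∣a-b∣≡∣b-a∣ u t) ⟩
        (recip t ℚ.* recip u) ℚ.* ℚ.∣ t ℚ.- u ∣
          ≤⟨ ℚ.*-monoʳ-≤-nonNeg ℚ.∣ t ℚ.- u ∣ {{ℚ.∣-∣-nonNeg (t ℚ.- u)}}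
               (*-mono-nonNeg (recip-nonNeg c 0<c) (recip-nonNeg u 0<u)
                 (recip-antitone c t 0<c c≤t) (recip-antitone c u 0<c c≤u)) ⟩
        (recip c ℚ.* recip c) ℚ.* ℚ.∣ t ℚ.- u ∣ ∎
      where
      open ℚ.≤-Reasoning
      c≤t = segment-≥-min x t seg-t
      c≤u = segment-≥-min x u seg-u
      0<t = ℚ.<-≤-trans 0<c c≤t
      0<u = ℚ.<-≤-trans 0<c c≤u

open RecipLemmas

log : (x : ℚ) → .{{Positive x}} → ℝ
log x = integral recip 1ℚ x (recip-lipschitz x)

infixl 7 _÷_

_÷_ : (i d : ℤ) → .{{ℤ.NonZero d}} → ℚ
(i ÷ d) {{d≢0}} = ((i / 1) ℚ.÷ (d / 1)) {{/1-nonZero d {{d≢0}}}}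
  where
  /1-nonZero : ∀ d → .{{ℤ.NonZero d}} → ℚ.NonZero (d / 1)
  /1-nonZero +[1+ n ] = ℚ.pos⇒nonZero (+[1+ n ] / 1) {{ℚ.normalize-pos (suc n) 1}}
  /1-nonZero -[1+ n ] = ℚ.neg⇒nonZero (-[1+ n ] / 1)
    {{ℚ.neg-pos {+[1+ n ] / 1} (ℚ.normalize-pos (suc n) 1)}}

denominator : ℤ → ℕ → ℤ
denominator x k =
  + k ℤ.* (+ 3 ℤ.* + k ℤ.- + 1) ℤ.* (+ 3 ℤ.* + k ℤ.- + 2) ℤ.* x ℤ.^ k
    ℤ.* + ((4 ℕ.* k) C k)

module DenominatorLemmas where

  nCk-nonZero : ∀ n k → k ℕ.≤ n → ℕ.NonZero (n C k)
  nCk-nonZero n k k≤n = subst ℕ.NonZero (sym (nCk≡n!/k![n-k]! k≤n))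
    (ℕ.>-nonZero (ℕ.m≥n⇒m/n>0 (ℕ.∣⇒≤ {{n ℕ.!≢0}} (k![n∸k]!∣n! k≤n))))
    where instance _ = k ℕ.!* (n ℕ.∸ k) !≢0

  ^-nonZero : ∀ x k → .{{ℤ.NonZero x}} → ℤ.NonZero (x ℤ.^ k)
  ^-nonZero x zero    = _
  ^-nonZero x (suc k) = ℤ.i*j≢0 x (x ℤ.^ k) {{it}} {{^-nonZero x k}}

  pos-nonZero : ∀ k → .{{ℕ.NonZero k}} → ℤ.NonZero (+ k)
  pos-nonZero (suc _) = _

  3k-1-nonZero : ∀ k → .{{ℕ.NonZero k}} → ℤ.NonZero (+ 3 ℤ.* + k ℤ.- + 1)
  3k-1-nonZero (suc j) rewrite ℕ.+-suc j (j ℕ.+ suc (j ℕ.+ 0)) = _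

  3k-2-nonZero : ∀ k → .{{ℕ.NonZero k}} → ℤ.NonZero (+ 3 ℤ.* + k ℤ.- + 2)
  3k-2-nonZero (suc j)
    rewrite ℕ.+-suc j (j ℕ.+ suc (j ℕ.+ 0)) | ℕ.+-suc j (j ℕ.+ 0)
          | ℕ.+-suc j (j ℕ.+ (j ℕ.+ 0)) = _

  denominator≢0 : ∀ x k → .{{ℤ.NonZero x}} → .{{ℕ.NonZero k}} →
    ℤ.NonZero (denominator x k)
  denominator≢0 x k = ℤ.i*j≢0 d₃ (+ ((4 ℕ.* k) C k))
      {{ℤ.i*j≢0 d₂ (x ℤ.^ k)
        {{ℤ.i*j≢0 d₁ (+ 3 ℤ.* + k ℤ.- + 2)
          {{ℤ.i*j≢0 (+ k) (+ 3 ℤ.* + k ℤ.- + 1)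
            {{pos-nonZero k}} {{3k-1-nonZero k}}}}
          {{3k-2-nonZero k}}}}
        {{^-nonZero x k}}}}
      {{nCk-nonZero (4 ℕ.* k) k (ℕ.m≤n*m k 4)}}
    where
    d₁ = + k ℤ.* (+ 3 ℤ.* + k ℤ.- + 1)
    d₂ = d₁ ℤ.* (+ 3 ℤ.* + k ℤ.- + 2)
    d₃ = d₂ ℤ.* x ℤ.^ k

term : (P : ℕ → ℤ) (x : ℤ) → .{{ℤ.NonZero x}} → Terms
term P x k = (P k ÷ denominator x k) {{DenominatorLemmas.denominator≢0 x k}}

{-# OPTIONS --safe #-}

-- Put w = u v³ with {u , v} = {x , 1 - x}.  By the beta integral, term k of each
-- series is z⁻ᵏ ∫₀¹ wᵏ⁻¹ r for a cubic r satisfying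
--   r · (1 + (X - 1) x) = c (X - 1) (z - w),
-- because z - w, as a quartic in x, vanishes at x = 1/(1 - X).  Summing the
-- geometric progression, the N-th partial sum is
--   c ∫₀¹ (X - 1)/(1 + (X - 1) x) · (1 - (w/z)ᴺ) dx,
-- which tends to c log X since |w/z| ≤ 1/2.
module Submission where

open import Algebra.Bundles using (CommutativeRing)
import Algebra.Properties.CommutativeSemiring.Exp as Exp
open import Data.Integer.Base as ℤ using (ℤ; +_)
import Data.Integer.Properties as ℤ
open import Data.Nat.Base as ℕ using (ℕ; zero; suc; _!)
open import Data.Nat.Combinatorics using (_C_; nCk≡n!/k![n-k]!; k![n∸k]!∣n!)
import Data.Nat.DivMod as ℕ
import Data.Nat.Properties as ℕ
open import Data.Nat.Solver using () renaming (module +-*-Solver to ℕ-Solver)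
open import Data.Product.Base using (∃-syntax; _×_; _,_; proj₁; proj₂)
open import Data.Rational.Base as ℚ using (ℚ; 0ℚ; 1ℚ; ½; Positive; _/_; toℚᵘ)
import Data.Rational.Properties as ℚ
open import Data.Rational.Solver using (module +-*-Solver)
import Data.Rational.Unnormalised.Base as ℚᵘ
import Data.Rational.Unnormalised.Properties as ℚᵘ
open import Defs
  using (ℝ; Terms; ∑∞_≐_; term; denominator; partialSum; ∑; fromℕ; recip; log; seq; _·_; _÷_;
         module CauchyLemmas; module RiemannLemmas; module RecipLemmas; module DenominatorLemmas)
open import Relation.Binary.PropositionalEquality
open import Relation.Nullary.Decidable using (from-yes)

-- The number z is not free: it must be the value of w at the zero 1/(1 - X) of 1 + (X - 1) x, or
-- the division defining r would leave a remainder. For X = 2 that zero is -1, where u = 1 - x and v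
-- = x give 2 · (-1)³ = -2. The numerator then follows up to the scale c: with j = k - 1, the
-- integral of wʲ r is j! (3j)! / (4k)! times a cubic in k divisible by k, and the quotient of this
-- cubic by 3k is the numerator. For X = 2, c = 1 would leave thirds in it, whence c = -3.
--
-- Reals are Cauchy sequences of rationals and `log` is a sequence of left Riemann sums, so no
-- real-valued integral is formed. Beta integrals have rational values, approached by Riemann sums
-- with an explicit error K/(n + 1). For fixed N, the rational partial sum is compared with the n-th
-- approximation of the logarithm; K may depend on N, while the truncation error is uniform in n.

private module ℚ^ = Exp (CommutativeRing.commutativeSemiring ℚ.+-*-commutativeRing)

-- Left Riemann sums on [0,1] with explicit error.

module Integration where
  open ℚ^ using (_^_)
  open import Data.Rational.Base using (_+_; _*_; _-_; -_; _≤_; ∣_∣)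
  open CauchyLemmas using (∣a-b∣≡∣b-a∣)
  open RiemannLemmas
  open +-*-Solver

  mesh : ℕ → ℚ
  mesh n = + 1 / suc n

  node : ℕ → ℕ → ℚ
  node n i = fromℕ i * mesh n

  0≤mesh : ∀ n → 0ℚ ≤ mesh n
  0≤mesh n = ℚ.<⇒≤ (ℚ.positive⁻¹ (mesh n) {{0<1/n (suc n)}})

  0≤node : ∀ n i → 0ℚ ≤ node n i
  0≤node n i = *-nonNeg (0≤fromℕ i) (0≤mesh n)

  node≤1 : ∀ n i → i ℕ.≤ suc n → node n i ≤ 1ℚ
  node≤1 n i i≤n = subst (node n i ≤_) (fromℕ-inverse (suc n))
    (ℚ.*-monoʳ-≤-nonNeg (mesh n) {{ℚ.nonNegative (0≤mesh n)}} (fromℕ-mono i≤n))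

  -- Takes n + 1 cells, like the n-th approximation in `integral`, so that it can be matched with
  -- `log` index by index.
  unitSum : (ℚ → ℚ) → ℕ → ℚ
  unitSum f n = ∑ (suc n) (λ i → f (node n i) * mesh n)

  ∑-+ : ∀ n (f g : ℕ → ℚ) → ∑ n (λ i → f i + g i) ≡ ∑ n f + ∑ n g
  ∑-+ zero    f g = refl
  ∑-+ (suc n) f g = trans (cong (_+ (f n + g n)) (∑-+ n f g))
    (solve 4 (λ a b c d → (a :+ b) :+ (c :+ d) := (a :+ c) :+ (b :+ d)) refl
      (∑ n f) (∑ n g) (f n) (g n))

  ∑-* : ∀ c n f → ∑ n (λ i → c * f i) ≡ c * ∑ n f
  ∑-* c zero    f = sym (ℚ.*-zeroʳ c)
  ∑-* c (suc n) f = trans (cong (_+ c * f n) (∑-* c n f))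
    (sym (ℚ.*-distribˡ-+ c (∑ n f) (f n)))

  unitSum-cong : ∀ {f g} → (∀ x → f x ≡ g x) → ∀ n → unitSum f n ≡ unitSum g n
  unitSum-cong f≗g n = ∑-cong (suc n) (λ i → cong (_* mesh n) (f≗g (node n i)))

  unitSum-+ : ∀ f g n → unitSum (λ x → f x + g x) n ≡ unitSum f n + unitSum g n
  unitSum-+ f g n = trans
    (∑-cong (suc n) (λ i → ℚ.*-distribʳ-+ (mesh n) (f (node n i)) (g (node n i))))
    (∑-+ (suc n) (λ i → f (node n i) * mesh n) (λ i → g (node n i) * mesh n))

  unitSum-* : ∀ c f n → unitSum (λ x → c * f x) n ≡ c * unitSum f n
  unitSum-* c f n = trans
    (∑-cong (suc n) (λ i → ℚ.*-assoc c (f (node n i)) (mesh n)))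
    (∑-* c (suc n) (λ i → f (node n i) * mesh n))

  unitSum-close : (f g : ℚ → ℚ) (B : ℚ) →
    (∀ x → 0ℚ ≤ x → x ≤ 1ℚ → ∣ f x - g x ∣ ≤ B) →
    ∀ n → ∣ unitSum f n - unitSum g n ∣ ≤ B
  unitSum-close f g B close n = begin
      ∣ unitSum f n - unitSum g n ∣  ≤⟨ ∑-close (suc n) _ _ (B * h) cell ⟩
      fromℕ (suc n) * (B * h)        ≡⟨ regroup (fromℕ (suc n)) B h ⟩
      B * (fromℕ (suc n) * h)        ≡⟨ cong (B *_) (fromℕ-inverse (suc n)) ⟩
      B * 1ℚ                         ≡⟨ ℚ.*-identityʳ B ⟩
      B                              ∎
    where
    open ℚ.≤-Reasoning
    h = mesh n
    regroup : ∀ a b c → a * (b * c) ≡ b * (a * c)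
    regroup = solve 3 (λ a b c → a :* (b :* c) := b :* (a :* c)) refl
    factor : ∀ a b c → a * c - b * c ≡ (a - b) * c
    factor = solve 3 (λ a b c → a :* c :- b :* c := (a :- b) :* c) refl
    cell : ∀ i → i ℕ.< suc n → ∣ f (node n i) * h - g (node n i) * h ∣ ≤ B * h
    cell i i<n = begin
      ∣ f (node n i) * h - g (node n i) * h ∣
        ≡⟨ cong ∣_∣ (factor (f (node n i)) (g (node n i)) h) ⟩
      ∣ (f (node n i) - g (node n i)) * h ∣
        ≡⟨ ℚ.∣p*q∣≡∣p∣*∣q∣ (f (node n i) - g (node n i)) h ⟩
      ∣ f (node n i) - g (node n i) ∣ * ∣ h ∣
        ≡⟨ cong (∣ f (node n i) - g (node n i) ∣ *_) (ℚ.0≤p⇒∣p∣≡p (0≤mesh n)) ⟩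
      ∣ f (node n i) - g (node n i) ∣ * h
        ≤⟨ ℚ.*-monoʳ-≤-nonNeg h {{ℚ.nonNegative (0≤mesh n)}}
             (close (node n i) (0≤node n i) (node≤1 n i (ℕ.<⇒≤ i<n))) ⟩
      B * h ∎

  infix 4 _IntegratesTo_

  -- A rational value with an explicit rate is all that polynomial integrands require, and it is
  -- closed under linear combinations with no passage to a limit.
  record _IntegratesTo_ (f : ℚ → ℚ) (I : ℚ) : Set where
    constructor within
    field
      constant : ℚ
      bound    : ∀ n → ∣ unitSum f n - I ∣ ≤ constant * mesh n

  integ-cong : ∀ {f g I J} → (∀ x → f x ≡ g x) → I ≡ J →
    f IntegratesTo I → g IntegratesTo J
  integ-cong f≗g refl (within K bound) = within K λ n →
    subst (λ s → ∣ s - _ ∣ ≤ K * mesh n) (unitSum-cong f≗g n) (bound n)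

  integ-0 : (λ _ → 0ℚ) IntegratesTo 0ℚ
  integ-0 = within 0ℚ λ n → ℚ.≤-reflexive (begin
      ∣ unitSum (λ _ → 0ℚ) n - 0ℚ ∣
        ≡⟨ cong (λ s → ∣ s - 0ℚ ∣) (∑-const (suc n) (0ℚ * mesh n)) ⟩
      ∣ fromℕ (suc n) * (0ℚ * mesh n) - 0ℚ ∣
        ≡⟨ cong ∣_∣ (vanish (fromℕ (suc n)) (mesh n)) ⟩
      0ℚ
        ≡⟨ ℚ.*-zeroˡ (mesh n) ⟨
      0ℚ * mesh n ∎)
    where
    open ≡-Reasoning
    vanish : ∀ a b → a * (0ℚ * b) - 0ℚ ≡ 0ℚ
    vanish = solve 2 (λ a b → a :* (con 0ℚ :* b) :- con 0ℚ := con 0ℚ) refl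

  integ-+ : ∀ {f g I J} → f IntegratesTo I → g IntegratesTo J →
    (λ x → f x + g x) IntegratesTo (I + J)
  integ-+ {f} {g} {I} {J} (within K p) (within L q) = within (K + L) λ n → begin
      ∣ unitSum (λ x → f x + g x) n - (I + J) ∣
        ≡⟨ cong (λ s → ∣ s - (I + J) ∣) (unitSum-+ f g n) ⟩
      ∣ (unitSum f n + unitSum g n) - (I + J) ∣
        ≡⟨ cong ∣_∣ (CauchyLemmas.rearrange (unitSum f n) (unitSum g n) I J) ⟩
      ∣ (unitSum f n - I) + (unitSum g n - J) ∣
        ≤⟨ ℚ.∣p+q∣≤∣p∣+∣q∣ (unitSum f n - I) (unitSum g n - J) ⟩
      ∣ unitSum f n - I ∣ + ∣ unitSum g n - J ∣
        ≤⟨ ℚ.+-mono-≤ (p n) (q n) ⟩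
      K * mesh n + L * mesh n
        ≡⟨ ℚ.*-distribʳ-+ (mesh n) K L ⟨
      (K + L) * mesh n ∎
    where open ℚ.≤-Reasoning

  integ-* : ∀ c {f I} → f IntegratesTo I → (λ x → c * f x) IntegratesTo (c * I)
  integ-* c {f} {I} (within K p) = within (∣ c ∣ * K) λ n → begin
      ∣ unitSum (λ x → c * f x) n - c * I ∣
        ≡⟨ cong (λ s → ∣ s - c * I ∣) (unitSum-* c f n) ⟩
      ∣ c * unitSum f n - c * I ∣
        ≡⟨ cong ∣_∣ (factor c (unitSum f n) I) ⟩
      ∣ c * (unitSum f n - I) ∣
        ≡⟨ ℚ.∣p*q∣≡∣p∣*∣q∣ c (unitSum f n - I) ⟩
      ∣ c ∣ * ∣ unitSum f n - I ∣
        ≤⟨ ℚ.*-monoˡ-≤-nonNeg ∣ c ∣ {{ℚ.∣-∣-nonNeg c}} (p n) ⟩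
      ∣ c ∣ * (K * mesh n)
        ≡⟨ ℚ.*-assoc ∣ c ∣ K (mesh n) ⟨
      ∣ c ∣ * K * mesh n ∎
    where
    open ℚ.≤-Reasoning
    factor : ∀ c a b → c * a - c * b ≡ c * (a - b)
    factor = solve 3 (λ c a b → c :* a :- c :* b := c :* (a :- b)) refl

  -- Such an f is increasing, so its left Riemann sums lie below F 1 - F 0 and
  -- within (f 1 - f 0) h of it.
  integ-antiderivative : (F f : ℚ → ℚ) →
    (∀ x h → 0ℚ ≤ x → 0ℚ ≤ h → f x * h ≤ F (x + h) - F x) →
    (∀ x h → 0ℚ ≤ x → 0ℚ ≤ h → F (x + h) - F x ≤ f (x + h) * h) →
    f IntegratesTo (F 1ℚ - F 0ℚ)
  integ-antiderivative F f lower upper = within (f 1ℚ - f 0ℚ) λ n → begin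
      ∣ unitSum f n - (F 1ℚ - F 0ℚ) ∣
        ≡⟨ ∣a-b∣≡∣b-a∣ (unitSum f n) (F 1ℚ - F 0ℚ) ⟩
      ∣ (F 1ℚ - F 0ℚ) - unitSum f n ∣
        ≡⟨ ℚ.0≤p⇒∣p∣≡p (subst (_≤ (F 1ℚ - F 0ℚ) - unitSum f n) (ℚ.+-inverseʳ (unitSum f n))
             (ℚ.+-monoˡ-≤ (- unitSum f n) (below n))) ⟩
      (F 1ℚ - F 0ℚ) - unitSum f n
        ≤⟨ ℚ.+-monoˡ-≤ (- unitSum f n) (above n) ⟩
      (unitSum f n + (f 1ℚ - f 0ℚ) * mesh n) - unitSum f n
        ≡⟨ solve 2 (λ a b → (a :+ b) :- a := b) refl (unitSum f n) ((f 1ℚ - f 0ℚ) * mesh n) ⟩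
      (f 1ℚ - f 0ℚ) * mesh n ∎
    where
    open ℚ.≤-Reasoning
    node-suc : ∀ n i → node n i + mesh n ≡ node n (suc i)
    node-suc n i = sym (fromℕ-suc-* i (mesh n))
    left : ℕ → ℕ → ℚ
    left n k = ∑ k (λ i → f (node n i) * mesh n)
    telescope : ∀ a b c → (a - b) + (c - a) ≡ c - b
    telescope = solve 3 (λ a b c → (a :- b) :+ (c :- a) := c :- b) refl
    below-node : ∀ n k → left n k ≤ F (node n k) - F (node n 0)
    below-node n zero    = ℚ.≤-reflexive (sym (ℚ.+-inverseʳ (F (node n 0))))
    below-node n (suc k) = begin
      left n k + f (node n k) * mesh n
        ≤⟨ ℚ.+-mono-≤ (below-node n k) (lower (node n k) (mesh n) (0≤node n k) (0≤mesh n)) ⟩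
      (F (node n k) - F (node n 0)) + (F (node n k + mesh n) - F (node n k))
        ≡⟨ telescope (F (node n k)) (F (node n 0)) (F (node n k + mesh n)) ⟩
      F (node n k + mesh n) - F (node n 0)
        ≡⟨ cong (λ y → F y - F (node n 0)) (node-suc n k) ⟩
      F (node n (suc k)) - F (node n 0) ∎
    -- `upper` bounds increments by values at right endpoints. Shifting those back to left endpoints
    -- changes the sum by a telescoping amount: last value minus first, times the mesh.
    above-node : ∀ n k →
      F (node n k) - F (node n 0) ≤ left n k + (f (node n k) - f (node n 0)) * mesh n
    above-node n zero    = ℚ.≤-reflexive (solve 3
      (λ a b h → a :- a := con 0ℚ :+ (b :- b) :* h) refl (F (node n 0)) (f (node n 0)) (mesh n))
    above-node n (suc k) = begin
      F (node n (suc k)) - F (node n 0)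
        ≡⟨ cong (λ y → F y - F (node n 0)) (node-suc n k) ⟨
      F (node n k + mesh n) - F (node n 0)
        ≡⟨ telescope (F (node n k)) (F (node n 0)) (F (node n k + mesh n)) ⟨
      (F (node n k) - F (node n 0)) + (F (node n k + mesh n) - F (node n k))
        ≤⟨ ℚ.+-mono-≤ (above-node n k)
             (upper (node n k) (mesh n) (0≤node n k) (0≤mesh n)) ⟩
      (left n k + (f (node n k) - f (node n 0)) * mesh n) + f (node n k + mesh n) * mesh n
        ≡⟨ solve 5 (λ l a b c h →
             (l :+ (a :- b) :* h) :+ c :* h := (l :+ a :* h) :+ (c :- b) :* h) refl
             (left n k) (f (node n k)) (f (node n 0)) (f (node n k + mesh n)) (mesh n) ⟩
      left n (suc k) + (f (node n k + mesh n) - f (node n 0)) * mesh n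
        ≡⟨ cong (λ y → left n (suc k) + (f y - f (node n 0)) * mesh n) (node-suc n k) ⟩
      left n (suc k) + (f (node n (suc k)) - f (node n 0)) * mesh n ∎
    first : ∀ n → node n 0 ≡ 0ℚ
    first n = ℚ.*-zeroˡ (mesh n)
    last : ∀ n → node n (suc n) ≡ 1ℚ
    last n = fromℕ-inverse (suc n)
    below : ∀ n → unitSum f n ≤ F 1ℚ - F 0ℚ
    below n = subst₂ (λ a b → unitSum f n ≤ F b - F a) (first n) (last n)
      (below-node n (suc n))
    above : ∀ n → F 1ℚ - F 0ℚ ≤ unitSum f n + (f 1ℚ - f 0ℚ) * mesh n
    above n = subst₂ (λ a b → F b - F a ≤ unitSum f n + (f b - f a) * mesh n)
      (first n) (last n) (above-node n (suc n))

  0≤1 : 0ℚ ≤ 1ℚ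
  0≤1 = ℚ.nonNegative⁻¹ 1ℚ

  ^-nonNeg : ∀ {x} n → 0ℚ ≤ x → 0ℚ ≤ x ^ n
  ^-nonNeg zero    0≤x = 0≤1
  ^-nonNeg (suc n) 0≤x = *-nonNeg 0≤x (^-nonNeg n 0≤x)

  ^-mono : ∀ {x y} n → 0ℚ ≤ x → x ≤ y → x ^ n ≤ y ^ n
  ^-mono zero    0≤x x≤y = ℚ.≤-refl
  ^-mono (suc n) 0≤x x≤y =
    *-mono-nonNeg (ℚ.≤-trans 0≤x x≤y) (^-nonNeg n 0≤x) x≤y (^-mono n 0≤x x≤y)

  0^suc : ∀ n → 0ℚ ^ suc n ≡ 0ℚ
  0^suc n = ℚ.*-zeroˡ (0ℚ ^ n)

  1^n : ∀ n → 1ℚ ^ n ≡ 1ℚ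
  1^n zero    = refl
  1^n (suc n) = trans (ℚ.*-identityˡ (1ℚ ^ n)) (1^n n)

  -- The antiderivative x^(m+1) belongs to (m + 1) x^m, so the factor m + 1 is inserted and
  -- cancelled by `mesh m`. Both increment bounds follow by induction on m from `split`, which peels
  -- one factor off a difference of powers.
  integ-^ : ∀ m → (λ x → x ^ m) IntegratesTo mesh m
  integ-^ m = integ-cong
      (λ x → trans (sym (ℚ.*-assoc (mesh m) (fromℕ (suc m)) (x ^ m)))
        (trans (cong (_* x ^ m) (trans (ℚ.*-comm (mesh m) (fromℕ (suc m))) (fromℕ-inverse (suc m))))
          (ℚ.*-identityˡ (x ^ m))))
      (trans (cong₂ (λ a b → mesh m * (a - b)) (1^n (suc m)) (0^suc m))
        (trans (cong (mesh m *_) (ℚ.+-identityʳ 1ℚ)) (ℚ.*-identityʳ (mesh m))))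
      (integ-* (mesh m)
        (integ-antiderivative (_^ suc m) (λ x → fromℕ (suc m) * x ^ m) (lower m) (upper m)))
    where
    open ℚ.≤-Reasoning
    split : ∀ x h a b → (x + h) * a - x * b ≡ (x + h) * (a - b) + b * h
    split = solve 4 (λ x h a b → (x :+ h) :* a :- x :* b := (x :+ h) :* (a :- b) :+ b :* h) refl
    x≤x+h : ∀ {x h} → 0ℚ ≤ h → x ≤ x + h
    x≤x+h {x} {h} 0≤h = subst (_≤ x + h) (ℚ.+-identityʳ x) (ℚ.+-monoʳ-≤ x 0≤h)
    collect : ∀ n x p h → x * (fromℕ n * p * h) + x * p * h ≡ fromℕ (suc n) * (x * p) * h
    collect n x p h = trans
      (solve 4 (λ n x p h → x :* (n :* p :* h) :+ x :* p :* h := (n :* (x :* p) :+ x :* p) :* h)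
        refl (fromℕ n) x p h)
      (cong (_* h) (sym (fromℕ-suc-* n (x * p))))
    power-diff : ∀ x h → (x + h) * 1ℚ - x * 1ℚ ≡ 1ℚ * 1ℚ * h
    power-diff = solve 2 (λ x h → (x :+ h) :* con 1ℚ :- x :* con 1ℚ := con 1ℚ :* con 1ℚ :* h) refl
    lower : ∀ m x h → 0ℚ ≤ x → 0ℚ ≤ h →
      fromℕ (suc m) * x ^ m * h ≤ (x + h) ^ suc m - x ^ suc m
    lower zero    x h 0≤x 0≤h = ℚ.≤-reflexive (sym (power-diff x h))
    lower (suc m) x h 0≤x 0≤h = begin
      fromℕ (suc (suc m)) * (x * x ^ m) * h
        ≡⟨ collect (suc m) x (x ^ m) h ⟨
      x * (fromℕ (suc m) * x ^ m * h) + x ^ suc m * h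
        ≤⟨ ℚ.+-monoˡ-≤ (x ^ suc m * h) (*-mono-nonNeg {x} (ℚ.≤-trans 0≤x (x≤x+h 0≤h))
             (*-nonNeg (*-nonNeg (0≤fromℕ (suc m)) (^-nonNeg m 0≤x)) 0≤h)
             (x≤x+h 0≤h) (lower m x h 0≤x 0≤h)) ⟩
      (x + h) * ((x + h) ^ suc m - x ^ suc m) + x ^ suc m * h
        ≡⟨ split x h ((x + h) ^ suc m) (x ^ suc m) ⟨
      (x + h) ^ suc (suc m) - x ^ suc (suc m) ∎
    upper : ∀ m x h → 0ℚ ≤ x → 0ℚ ≤ h →
      (x + h) ^ suc m - x ^ suc m ≤ fromℕ (suc m) * (x + h) ^ m * h
    upper zero    x h 0≤x 0≤h = ℚ.≤-reflexive (power-diff x h)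
    upper (suc m) x h 0≤x 0≤h = begin
      (x + h) ^ suc (suc m) - x ^ suc (suc m)
        ≡⟨ split x h ((x + h) ^ suc m) (x ^ suc m) ⟩
      (x + h) * ((x + h) ^ suc m - x ^ suc m) + x ^ suc m * h
        ≤⟨ ℚ.+-mono-≤
             (ℚ.*-monoˡ-≤-nonNeg (x + h) {{ℚ.nonNegative (ℚ.≤-trans 0≤x (x≤x+h 0≤h))}}
               (upper m x h 0≤x 0≤h))
             (ℚ.*-monoʳ-≤-nonNeg h {{ℚ.nonNegative 0≤h}} (^-mono (suc m) 0≤x (x≤x+h 0≤h))) ⟩
      (x + h) * (fromℕ (suc m) * (x + h) ^ m * h) + (x + h) ^ suc m * h
        ≡⟨ collect (suc m) (x + h) ((x + h) ^ m) h ⟩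
      fromℕ (suc (suc m)) * (x + h) ^ suc m * h ∎

open Integration

-- Beta integrals at integer arguments.

module Beta where
  open ℚ^ using (_^_)
  open import Data.Rational.Base using (_+_; _*_; _-_; -_)
  open RiemannLemmas
  open +-*-Solver

  fact : ℕ → ℚ
  fact n = fromℕ (n !)

  -- The reciprocal of n !, built as a product of reciprocals so that no division by a factorial,
  -- with its nonzero proof, occurs.
  invFact : ℕ → ℚ
  invFact zero    = 1ℚ
  invFact (suc n) = invFact n * mesh n

  fact-suc : ∀ n → fact (suc n) ≡ fromℕ (suc n) * fact n
  fact-suc n = fromℕ-* (suc n) (n !)

  fact-invFact : ∀ n → fact n * invFact n ≡ 1ℚ
  fact-invFact zero    = refl
  fact-invFact (suc n) = begin
      fact (suc n) * (invFact n * mesh n)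
        ≡⟨ cong (_* (invFact n * mesh n)) (fact-suc n) ⟩
      (fromℕ (suc n) * fact n) * (invFact n * mesh n)
        ≡⟨ solve 4 (λ a b c d → (a :* b) :* (c :* d) := (a :* d) :* (b :* c)) refl
             (fromℕ (suc n)) (fact n) (invFact n) (mesh n) ⟩
      (fromℕ (suc n) * mesh n) * (fact n * invFact n)
        ≡⟨ cong₂ _*_ (fromℕ-inverse (suc n)) (fact-invFact n) ⟩
      1ℚ * 1ℚ ∎
    where open ≡-Reasoning

  invFact-pred : ∀ n → invFact n ≡ invFact (suc n) * fromℕ (suc n)
  invFact-pred n = sym (begin
      (invFact n * mesh n) * fromℕ (suc n)  ≡⟨ ℚ.*-assoc (invFact n) (mesh n) (fromℕ (suc n)) ⟩
      invFact n * (mesh n * fromℕ (suc n))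
        ≡⟨ cong (invFact n *_) (trans (ℚ.*-comm (mesh n) (fromℕ (suc n))) (fromℕ-inverse (suc n))) ⟩
      invFact n * 1ℚ                        ≡⟨ ℚ.*-identityʳ (invFact n) ⟩
      invFact n                             ∎)
    where open ≡-Reasoning

  -- Euler's B(i + 1, j + 1) = i! j! / (i + j + 1)!.
  β : ℕ → ℕ → ℚ
  β i j = fact i * fact j * invFact (suc (i ℕ.+ j))

  β-index : ∀ i j {s} → i ℕ.+ j ≡ s → β i j ≡ fact i * fact j * invFact (suc s)
  β-index i j refl = refl

  β-sym : ∀ i j → β i j ≡ β j i
  β-sym i j = trans (cong (_* invFact (suc (i ℕ.+ j))) (ℚ.*-comm (fact i) (fact j)))
    (sym (β-index j i (ℕ.+-comm j i)))

  β-zero : ∀ i → mesh i ≡ β i 0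
  β-zero i = sym (begin
      β i 0
        ≡⟨ β-index i 0 (ℕ.+-identityʳ i) ⟩
      fact i * 1ℚ * (invFact i * mesh i)
        ≡⟨ solve 3 (λ a b c → a :* con 1ℚ :* (b :* c) := (a :* b) :* c) refl
             (fact i) (invFact i) (mesh i) ⟩
      (fact i * invFact i) * mesh i
        ≡⟨ cong (_* mesh i) (fact-invFact i) ⟩
      1ℚ * mesh i
        ≡⟨ ℚ.*-identityˡ (mesh i) ⟩
      mesh i ∎)
    where open ≡-Reasoning

  -- Over the common denominator (i + j + 2)!, this is (i + j + 2) - (i + 1) = j + 1.
  β-suc : ∀ i j → β i j + (- 1ℚ) * β (suc i) j ≡ β i (suc j)
  β-suc i j = begin
      fact i * fact j * invFact (suc s) + (- 1ℚ) * (fact (suc i) * fact j * V)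
        ≡⟨ cong₂ (λ a b → fact i * fact j * a + (- 1ℚ) * (b * fact j * V))
             (trans (invFact-pred (suc s)) (cong (V *_) size)) (fact-suc i) ⟩
      fact i * fact j * (V * (m + n)) + (- 1ℚ) * (m * fact i * fact j * V)
        ≡⟨ solve 5 (λ a b v m n →
             a :* b :* (v :* (m :+ n)) :+ (:- con 1ℚ) :* (m :* a :* b :* v) := a :* (n :* b) :* v)
             refl (fact i) (fact j) V m n ⟩
      fact i * (n * fact j) * V
        ≡⟨ cong (λ a → fact i * a * V) (fact-suc j) ⟨
      fact i * fact (suc j) * V
        ≡⟨ β-index i (suc j) (ℕ.+-suc i j) ⟨
      β i (suc j) ∎
    where
    open ≡-Reasoning
    s = i ℕ.+ j
    V = invFact (suc (suc s))
    m = fromℕ (suc i)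
    n = fromℕ (suc j)
    size : fromℕ (suc (suc s)) ≡ m + n
    size = trans (cong fromℕ (cong suc (sym (ℕ.+-suc i j)))) (fromℕ-+ (suc i) (suc j))

  -- Induction on j with i left free: writing one factor 1 - x as a difference lowers j at the price
  -- of raising i, which replaces integration by parts.
  integ-β : ∀ i j → (λ x → x ^ i * (1ℚ - x) ^ j) IntegratesTo β i j
  integ-β i zero    = integ-cong (λ x → sym (ℚ.*-identityʳ (x ^ i))) (β-zero i) (integ-^ i)
  integ-β i (suc j) = integ-cong
    (λ x → solve 3 (λ x p q →
      p :* q :+ (:- con 1ℚ) :* ((x :* p) :* q) := p :* ((con 1ℚ :- x) :* q))
      refl x (x ^ i) ((1ℚ - x) ^ j))
    (β-suc i j)
    (integ-+ (integ-β i j) (integ-* (- 1ℚ) (integ-β (suc i) j)))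

  integ-β-reflected : ∀ i j → (λ x → (1ℚ - x) ^ i * x ^ j) IntegratesTo β i j
  integ-β-reflected i j = integ-cong
    (λ x → ℚ.*-comm (x ^ j) ((1ℚ - x) ^ i)) (β-sym j i) (integ-β j i)

-- Series terms as combinations of beta integrals.

module Moments where
  open ℚ^ using (_^_; ^-distrib-*)
  open import Data.Rational.Base using (_+_; _*_; _-_; -_)
  open RiemannLemmas
  open Beta
  open +-*-Solver

  fromℤ : ℤ → ℚ
  fromℤ i = i / 1

  fromℤ-+ : ∀ i j → fromℤ (i ℤ.+ j) ≡ fromℤ i + fromℤ j
  fromℤ-+ i j = ℚ.toℚᵘ-injective (begin
      toℚᵘ (fromℤ (i ℤ.+ j))                    ≈⟨ ℚ.toℚᵘ-fromℚᵘ (ℚᵘ.mkℚᵘ (i ℤ.+ j) 0) ⟩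
      ℚᵘ.mkℚᵘ (i ℤ.+ j) 0                        ≈⟨ ℚᵘ.*≡* (cong (ℤ._* + 1)
        (sym (cong₂ ℤ._+_ (ℤ.*-identityʳ i) (ℤ.*-identityʳ j)))) ⟩
      ℚᵘ.mkℚᵘ i 0 ℚᵘ.+ ℚᵘ.mkℚᵘ j 0               ≈⟨ ℚᵘ.+-cong (ℚ.toℚᵘ-fromℚᵘ (ℚᵘ.mkℚᵘ i 0))
                                                              (ℚ.toℚᵘ-fromℚᵘ (ℚᵘ.mkℚᵘ j 0)) ⟨
      toℚᵘ (fromℤ i) ℚᵘ.+ toℚᵘ (fromℤ j)        ≈⟨ ℚ.toℚᵘ-homo-+ (fromℤ i) (fromℤ j) ⟨
      toℚᵘ (fromℤ i + fromℤ j)                  ∎)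
    where open ℚᵘ.≃-Reasoning

  fromℤ-* : ∀ i j → fromℤ (i ℤ.* j) ≡ fromℤ i * fromℤ j
  fromℤ-* i j = ℚ.toℚᵘ-injective (begin
      toℚᵘ (fromℤ (i ℤ.* j))                    ≈⟨ ℚ.toℚᵘ-fromℚᵘ (ℚᵘ.mkℚᵘ (i ℤ.* j) 0) ⟩
      ℚᵘ.mkℚᵘ i 0 ℚᵘ.* ℚᵘ.mkℚᵘ j 0               ≈⟨ ℚᵘ.*-cong (ℚ.toℚᵘ-fromℚᵘ (ℚᵘ.mkℚᵘ i 0))
                                                              (ℚ.toℚᵘ-fromℚᵘ (ℚᵘ.mkℚᵘ j 0)) ⟨
      toℚᵘ (fromℤ i) ℚᵘ.* toℚᵘ (fromℤ j)        ≈⟨ ℚ.toℚᵘ-homo-* (fromℤ i) (fromℤ j) ⟨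
      toℚᵘ (fromℤ i * fromℤ j)                  ∎)
    where open ℚᵘ.≃-Reasoning

  fromℤ-neg : ∀ i → fromℤ (ℤ.- i) ≡ - fromℤ i
  fromℤ-neg (+ zero)       = refl
  fromℤ-neg (+ suc n)      = refl
  fromℤ-neg (ℤ.-[1+ n ])   = solve 1 (λ a → a := :- (:- a)) refl (fromℕ (suc n))

  fromℤ-minus : ∀ i j → fromℤ (i ℤ.- j) ≡ fromℤ i - fromℤ j
  fromℤ-minus i j = trans (fromℤ-+ i (ℤ.- j)) (cong (λ q → fromℤ i + q) (fromℤ-neg j))

  fromℤ-^ : ∀ i n → fromℤ (i ℤ.^ n) ≡ fromℤ i ^ n
  fromℤ-^ i zero    = refl
  fromℤ-^ i (suc n) = trans (fromℤ-* i (i ℤ.^ n)) (cong (fromℤ i *_) (fromℤ-^ i n))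

  fromℤ-nonZero : ∀ d → .{{ℤ.NonZero d}} → ℚ.NonZero (fromℤ d)
  fromℤ-nonZero ℤ.+[1+ n ] = ℚ.pos⇒nonZero (fromℕ (suc n)) {{ℚ.normalize-pos (suc n) 1}}
  fromℤ-nonZero ℤ.-[1+ n ] = ℚ.neg⇒nonZero (fromℤ ℤ.-[1+ n ])
    {{ℚ.neg-pos {fromℕ (suc n)} (ℚ.normalize-pos (suc n) 1)}}

  ℚ÷-unique : ∀ p d .{{_ : ℚ.NonZero d}} q → q * d ≡ p → p ℚ.÷ d ≡ q
  ℚ÷-unique p d q qd≡p = begin
      p * ℚ.1/ d           ≡⟨ cong (_* ℚ.1/ d) qd≡p ⟨
      q * d * ℚ.1/ d       ≡⟨ ℚ.*-assoc q d (ℚ.1/ d) ⟩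
      q * (d * ℚ.1/ d)     ≡⟨ cong (q *_) (ℚ.*-inverseʳ d) ⟩
      q * 1ℚ               ≡⟨ ℚ.*-identityʳ q ⟩
      q                    ∎
    where open ≡-Reasoning

  ÷-unique : ∀ i d .{{_ : ℤ.NonZero d}} q → q * fromℤ d ≡ fromℤ i → i ÷ d ≡ q
  ÷-unique i d q = ℚ÷-unique (fromℤ i) (fromℤ d) {{fromℤ-nonZero d}} q

  binomial-fact : ∀ k → fromℕ ((4 ℕ.* k) C k) * (fact k * fact (3 ℕ.* k)) ≡ fact (4 ℕ.* k)
  binomial-fact k = trans
    (sym (trans (fromℕ-* ((4 ℕ.* k) C k) (k ! ℕ.* (3 ℕ.* k) !))
      (cong (fromℕ ((4 ℕ.* k) C k) *_) (fromℕ-* (k !) ((3 ℕ.* k) !)))))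
    (cong fromℕ (begin
      ((4 ℕ.* k) C k) ℕ.* (k ! ℕ.* (3 ℕ.* k) !)
        ≡⟨ cong (λ m → ((4 ℕ.* k) C k) ℕ.* (k ! ℕ.* m !)) (ℕ.m+n∸m≡n k (3 ℕ.* k)) ⟨
      ((4 ℕ.* k) C k) ℕ.* (k ! ℕ.* (4 ℕ.* k ℕ.∸ k) !)
        ≡⟨ cong (ℕ._* (k ! ℕ.* (4 ℕ.* k ℕ.∸ k) !)) (nCk≡n!/k![n-k]! k≤4k) ⟩
      _
        ≡⟨ ℕ.m/n*n≡m (k![n∸k]!∣n! k≤4k) ⟩
      (4 ℕ.* k) ! ∎))
    where
    open ≡-Reasoning
    k≤4k = ℕ.m≤n*m k 4
    instance _ = k ℕ.!* (4 ℕ.* k ℕ.∸ k) !≢0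

  -- The integral over [0,1] of (u v³)ʲ (r₀ v³ + r₁ u v² + r₂ u² v + r₃ u³) for
  -- {u , v} = {x , 1 - x}.
  moment : (r₀ r₁ r₂ r₃ : ℚ) → ℕ → ℚ
  moment r₀ r₁ r₂ r₃ j =
    r₀ * β j (3 ℕ.+ 3 ℕ.* j) + r₁ * β (1 ℕ.+ j) (2 ℕ.+ 3 ℕ.* j) +
    r₂ * β (2 ℕ.+ j) (1 ℕ.+ 3 ℕ.* j) + r₃ * β (3 ℕ.+ j) (3 ℕ.* j)

  -- The rising products by which the factorials in `moment` exceed j! and (3j)!. The argument j is
  -- rational, so that identities in it are polynomial identities within reach of the ring solver.
  weight : (r₀ r₁ r₂ r₃ j : ℚ) → ℚ
  weight r₀ r₁ r₂ r₃ j =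
    r₀ * ((fromℕ 3 + fromℕ 3 * j) * (fromℕ 2 + fromℕ 3 * j) * (1ℚ + fromℕ 3 * j)) +
    r₁ * ((1ℚ + j) * (fromℕ 2 + fromℕ 3 * j) * (1ℚ + fromℕ 3 * j)) +
    r₂ * ((fromℕ 2 + j) * (1ℚ + j) * (1ℚ + fromℕ 3 * j)) +
    r₃ * ((fromℕ 3 + j) * (fromℕ 2 + j) * (1ℚ + j))

  fact-1+ : ∀ n {q} → fromℕ n ≡ q → fact (1 ℕ.+ n) ≡ (1ℚ + q) * fact n
  fact-1+ n refl = trans (fact-suc n) (cong (_* fact n) (fromℕ-+ 1 n))

  fact-2+ : ∀ n {q} → fromℕ n ≡ q → fact (2 ℕ.+ n) ≡ (fromℕ 2 + q) * ((1ℚ + q) * fact n)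
  fact-2+ n eq@refl = trans (fact-suc (1 ℕ.+ n)) (cong₂ _*_ (fromℕ-+ 2 n) (fact-1+ n eq))

  fact-3+ : ∀ n {q} → fromℕ n ≡ q →
    fact (3 ℕ.+ n) ≡ (fromℕ 3 + q) * ((fromℕ 2 + q) * ((1ℚ + q) * fact n))
  fact-3+ n eq@refl = trans (fact-suc (2 ℕ.+ n)) (cong₂ _*_ (fromℕ-+ 3 n) (fact-2+ n eq))

  -- In all four beta values the arguments add up to 3 + 4j, so they share the denominator (4j +
  -- 4)!.
  moment-weight : ∀ r₀ r₁ r₂ r₃ j → moment r₀ r₁ r₂ r₃ j ≡
    fact j * fact (3 ℕ.* j) * invFact (4 ℕ.* suc j) * weight r₀ r₁ r₂ r₃ (fromℕ j)
  moment-weight r₀ r₁ r₂ r₃ j = begin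
      moment r₀ r₁ r₂ r₃ j
        ≡⟨ cong₂ _+_ (cong₂ _+_ (cong₂ _+_
             (cong (r₀ *_) (β-index j (3 ℕ.+ 3 ℕ.* j) (index₀ j)))
             (cong (r₁ *_) (β-index (1 ℕ.+ j) (2 ℕ.+ 3 ℕ.* j) (index₁ j))))
             (cong (r₂ *_) (β-index (2 ℕ.+ j) (1 ℕ.+ 3 ℕ.* j) (index₂ j))))
             (cong (r₃ *_) (β-index (3 ℕ.+ j) (3 ℕ.* j) (index₃ j))) ⟩
      r₀ * (F * fact (3 ℕ.+ 3 ℕ.* j) * V) + r₁ * (fact (1 ℕ.+ j) * fact (2 ℕ.+ 3 ℕ.* j) * V) +
      r₂ * (fact (2 ℕ.+ j) * fact (1 ℕ.+ 3 ℕ.* j) * V) + r₃ * (fact (3 ℕ.+ j) * G * V)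
        ≡⟨ cong₂ _+_ (cong₂ _+_ (cong₂ _+_
             (cong (λ a → r₀ * (F * a * V)) (fact-3+ (3 ℕ.* j) (fromℕ-* 3 j)))
             (cong₂ (λ a b → r₁ * (a * b * V)) (fact-1+ j refl) (fact-2+ (3 ℕ.* j) (fromℕ-* 3 j))))
             (cong₂ (λ a b → r₂ * (a * b * V)) (fact-2+ j refl) (fact-1+ (3 ℕ.* j) (fromℕ-* 3 j))))
             (cong (λ a → r₃ * (a * G * V)) (fact-3+ j refl)) ⟩
      _
        ≡⟨ solve 13 (λ r₀ r₁ r₂ r₃ f g v a₁ a₂ a₃ b₁ b₂ b₃ →
             r₀ :* (f :* (b₃ :* (b₂ :* (b₁ :* g))) :* v) :+
             r₁ :* (a₁ :* f :* (b₂ :* (b₁ :* g)) :* v) :+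
             r₂ :* (a₂ :* (a₁ :* f) :* (b₁ :* g) :* v) :+
             r₃ :* (a₃ :* (a₂ :* (a₁ :* f)) :* g :* v) :=
             f :* g :* v :* (r₀ :* (b₃ :* b₂ :* b₁) :+ r₁ :* (a₁ :* b₂ :* b₁) :+
                             r₂ :* (a₂ :* a₁ :* b₁) :+ r₃ :* (a₃ :* a₂ :* a₁)))
             refl r₀ r₁ r₂ r₃ F G V
             (1ℚ + fromℕ j) (fromℕ 2 + fromℕ j) (fromℕ 3 + fromℕ j)
             (1ℚ + fromℕ 3 * fromℕ j) (fromℕ 2 + fromℕ 3 * fromℕ j)
             (fromℕ 3 + fromℕ 3 * fromℕ j) ⟩
      F * G * V * weight r₀ r₁ r₂ r₃ (fromℕ j)
        ≡⟨ cong (λ n → F * G * invFact n * weight r₀ r₁ r₂ r₃ (fromℕ j)) (ℕ.*-suc 4 j) ⟨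
      F * G * invFact (4 ℕ.* suc j) * weight r₀ r₁ r₂ r₃ (fromℕ j) ∎
    where
    open ≡-Reasoning
    F = fact j
    G = fact (3 ℕ.* j)
    V = invFact (4 ℕ.+ 4 ℕ.* j)
    open ℕ-Solver using () renaming (_:+_ to _⊕_; _:*_ to _⊗_; _:=_ to _≋_; con to lit; solve to solveℕ)
    index₀ : ∀ j → j ℕ.+ (3 ℕ.+ 3 ℕ.* j) ≡ 3 ℕ.+ 4 ℕ.* j
    index₀ = solveℕ 1 (λ j → j ⊕ (lit 3 ⊕ lit 3 ⊗ j) ≋ lit 3 ⊕ lit 4 ⊗ j) refl
    index₁ : ∀ j → (1 ℕ.+ j) ℕ.+ (2 ℕ.+ 3 ℕ.* j) ≡ 3 ℕ.+ 4 ℕ.* j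
    index₁ = solveℕ 1 (λ j → (lit 1 ⊕ j) ⊕ (lit 2 ⊕ lit 3 ⊗ j) ≋ lit 3 ⊕ lit 4 ⊗ j) refl
    index₂ : ∀ j → (2 ℕ.+ j) ℕ.+ (1 ℕ.+ 3 ℕ.* j) ≡ 3 ℕ.+ 4 ℕ.* j
    index₂ = solveℕ 1 (λ j → (lit 2 ⊕ j) ⊕ (lit 1 ⊕ lit 3 ⊗ j) ≋ lit 3 ⊕ lit 4 ⊗ j) refl
    index₃ : ∀ j → (3 ℕ.+ j) ℕ.+ 3 ℕ.* j ≡ 3 ℕ.+ 4 ℕ.* j
    index₃ = solveℕ 1 (λ j → (lit 3 ⊕ j) ⊕ lit 3 ⊗ j ≋ lit 3 ⊕ lit 4 ⊗ j) refl

  denominator-value : ∀ z j → fromℤ (denominator z (suc j)) ≡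
    (1ℚ + fromℕ j) * (fromℕ 2 + fromℕ 3 * fromℕ j) * (1ℚ + fromℕ 3 * fromℕ j) *
      fromℤ z ^ suc j * fromℕ ((4 ℕ.* suc j) C suc j)
  denominator-value z j = begin
      fromℤ (denominator z (suc j))
        ≡⟨ fromℤ-* (k ℤ.* k₁ ℤ.* k₂ ℤ.* z ℤ.^ suc j) (+ ((4 ℕ.* suc j) C suc j)) ⟩
      fromℤ (k ℤ.* k₁ ℤ.* k₂ ℤ.* z ℤ.^ suc j) * c
        ≡⟨ cong (_* c) (fromℤ-* (k ℤ.* k₁ ℤ.* k₂) (z ℤ.^ suc j)) ⟩
      fromℤ (k ℤ.* k₁ ℤ.* k₂) * fromℤ (z ℤ.^ suc j) * c
        ≡⟨ cong₂ (λ a b → a * b * c)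
             (trans (fromℤ-* (k ℤ.* k₁) k₂) (cong (_* fromℤ k₂) (fromℤ-* k k₁)))
             (fromℤ-^ z (suc j)) ⟩
      fromℕ (suc j) * fromℤ k₁ * fromℤ k₂ * fromℤ z ^ suc j * c
        ≡⟨ cong (λ a → a * fromℤ z ^ suc j * c)
             (cong₂ _*_ (cong₂ _*_ (fromℕ-+ 1 j) (linear (+ 1))) (linear (+ 2))) ⟩
      (1ℚ + fromℕ j) * (fromℕ 3 * (1ℚ + fromℕ j) - 1ℚ) * (fromℕ 3 * (1ℚ + fromℕ j) - fromℕ 2) *
        fromℤ z ^ suc j * c
        ≡⟨ cong₂ (λ a b → (1ℚ + fromℕ j) * a * b * fromℤ z ^ suc j * c)
             (solve 1 (λ x → con (fromℕ 3) :* (con 1ℚ :+ x) :- con 1ℚ :=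
               con (fromℕ 2) :+ con (fromℕ 3) :* x) refl (fromℕ j))
             (solve 1 (λ x → con (fromℕ 3) :* (con 1ℚ :+ x) :- con (fromℕ 2) :=
               con 1ℚ :+ con (fromℕ 3) :* x) refl (fromℕ j)) ⟩
      (1ℚ + fromℕ j) * (fromℕ 2 + fromℕ 3 * fromℕ j) * (1ℚ + fromℕ 3 * fromℕ j) *
        fromℤ z ^ suc j * c ∎
    where
    open ≡-Reasoning
    k  = + suc j
    k₁ = + 3 ℤ.* k ℤ.- + 1
    k₂ = + 3 ℤ.* k ℤ.- + 2
    c  = fromℕ ((4 ℕ.* suc j) C suc j)
    linear : ∀ d → fromℤ (+ 3 ℤ.* k ℤ.- d) ≡ fromℕ 3 * (1ℚ + fromℕ j) - fromℤ d
    linear d = trans (fromℤ-minus (+ 3 ℤ.* k) d)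
      (cong (_- fromℤ d) (trans (fromℤ-* (+ 3) k) (cong (fromℕ 3 *_) (fromℕ-+ 1 j))))

  inverse-^ : ∀ p q n → p * q ≡ 1ℚ → p ^ n * q ^ n ≡ 1ℚ
  inverse-^ p q n pq≡1 =
    trans (sym (^-distrib-* p q n)) (trans (cong (_^ n) pq≡1) (1^n n))

  -- With k = j + 1, the reciprocal of k (3k - 1)(3k - 2) C(4k, k) is 3k · j! (3j)! / (4k)!. The
  -- factor 3k, absent from the denominator of the series, is why `weight` must equal 3k P(k).
  term-moment : ∀ P z .{{_ : ℤ.NonZero z}} ζ r₀ r₁ r₂ r₃ j → ζ * fromℤ z ≡ 1ℚ →
    weight r₀ r₁ r₂ r₃ (fromℕ j) ≡ fromℤ (P (suc j)) * (fromℕ 3 + fromℕ 3 * fromℕ j) →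
    term P z (suc j) ≡ ζ ^ suc j * moment r₀ r₁ r₂ r₃ j
  term-moment P z ζ r₀ r₁ r₂ r₃ j ζz≡1 weight≡ =
    ÷-unique (P k) (denominator z k) {{DenominatorLemmas.denominator≢0 z k}} _ (begin
      ζ ^ k * moment r₀ r₁ r₂ r₃ j * fromℤ (denominator z k)
        ≡⟨ cong₂ (λ a b → ζ ^ k * a * b)
             (trans (moment-weight r₀ r₁ r₂ r₃ j) (cong (F * G * V *_) weight≡))
             (denominator-value z j) ⟩
      ζ ^ k * (F * G * V * (p * (fromℕ 3 + fromℕ 3 * fromℕ j))) *
        ((1ℚ + fromℕ j) * (fromℕ 2 + fromℕ 3 * fromℕ j) * (1ℚ + fromℕ 3 * fromℕ j) *
          fromℤ z ^ k * c)
        -- Regroups towards factorials: k · j! = k! and 3k (3k - 1)(3k - 2) · (3j)! = (3k)!, which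
        -- the binomial coefficient turns into (4k)!.
        ≡⟨ solve 11 (λ a b c f g v p k₀ k₁ k₂ k₃ →
             a :* (f :* g :* v :* (p :* k₃)) :* (k₀ :* k₂ :* k₁ :* b :* c) :=
             p :* (a :* b) :* ((c :* ((k₀ :* f) :* (k₃ :* (k₂ :* (k₁ :* g))))) :* v))
             refl (ζ ^ k) (fromℤ z ^ k) c F G V p (1ℚ + fromℕ j) (1ℚ + fromℕ 3 * fromℕ j)
             (fromℕ 2 + fromℕ 3 * fromℕ j) (fromℕ 3 + fromℕ 3 * fromℕ j) ⟩
      p * (ζ ^ k * fromℤ z ^ k) *
        ((c * (((1ℚ + fromℕ j) * F) * ((fromℕ 3 + fromℕ 3 * fromℕ j) *
          ((fromℕ 2 + fromℕ 3 * fromℕ j) * ((1ℚ + fromℕ 3 * fromℕ j) * G))))) * V)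
        ≡⟨ cong₂ (λ a b → p * a * ((c * b) * V)) (inverse-^ ζ (fromℤ z) k ζz≡1)
             (cong₂ _*_ (sym (fact-1+ j refl))
               (sym (trans (cong fact (ℕ.*-suc 3 j)) (fact-3+ (3 ℕ.* j) (fromℕ-* 3 j))))) ⟩
      p * 1ℚ * ((c * (fact k * fact (3 ℕ.* k))) * V)
        ≡⟨ cong (λ a → p * 1ℚ * (a * V)) (binomial-fact k) ⟩
      p * 1ℚ * (fact (4 ℕ.* k) * V)
        ≡⟨ cong (p * 1ℚ *_) (fact-invFact (4 ℕ.* k)) ⟩
      p * 1ℚ * 1ℚ
        ≡⟨ trans (ℚ.*-identityʳ (p * 1ℚ)) (ℚ.*-identityʳ p) ⟩
      p ∎)
    where
    open ≡-Reasoning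
    k = suc j
    p = fromℤ (P k)
    c = fromℕ ((4 ℕ.* k) C k)
    F = fact j
    G = fact (3 ℕ.* j)
    V = invFact (4 ℕ.* k)

-- A convergence criterion and geometric decay.

module Convergence where
  open ℚ^ using (_^_)
  open import Data.Rational.Base using (_+_; _*_; _-_; _≤_; _<_; ∣_∣)
  open CauchyLemmas using (half-pos; half+half)
  open RiemannLemmas
  open +-*-Solver

  seq-partialSum : ∀ (a : Terms) N n → seq (partialSum a N) n ≡ ∑ N (λ j → a (suc j))
  seq-partialSum a zero    n = refl
  seq-partialSum a (suc N) n = cong (_+ a (suc N)) (seq-partialSum a N n)

  -- K may depend on N because the real inequality for the N-th partial sum only concerns large n,
  -- with N already fixed. B must serve all N at once.
  converges : ∀ (a : Terms) (x : ℝ) B →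
    (∀ N → ∃[ K ] (∀ n → ∣ ∑ N (λ j → a (suc j)) - seq x n ∣ ≤ B * mesh N + K * mesh n)) →
    ∑∞ a ≐ x
  converges a x B close ε 0<ε = proj₁ small-N , λ N N≥ →
    let K       = proj₁ (close N)
        small-n = eventually-small K η 0<η
    in δ , 0<δ , proj₁ small-n , λ n n≥ → begin
      ∣ seq (partialSum a N) n - seq x n ∣ + δ
        ≡⟨ cong (λ s → ∣ s - seq x n ∣ + δ) (seq-partialSum a N n) ⟩
      ∣ ∑ N (λ j → a (suc j)) - seq x n ∣ + δ
        ≤⟨ ℚ.+-monoˡ-≤ δ (proj₂ (close N) n) ⟩
      (B * mesh N + K * mesh n) + δ
        ≤⟨ ℚ.+-monoˡ-≤ δ (ℚ.+-mono-≤ (ℚ.<⇒≤ (proj₂ small-N N N≥)) (ℚ.<⇒≤ (proj₂ small-n n n≥))) ⟩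
      (η + η) + δ
        ≡⟨ cong (_+ δ) (half+half δ) ⟩
      δ + δ
        ≡⟨ half+half ε ⟩
      ε ∎
    where
    open ℚ.≤-Reasoning
    -- Half of ε is kept as the gap that `_<_` on reals demands; the two error terms get a quarter
    -- each.
    δ = ½ * ε
    η = ½ * δ
    0<δ = half-pos 0<ε
    0<η = half-pos 0<δ
    small-N = eventually-small B η 0<η

  integ-∑ : ∀ (g : ℕ → ℚ → ℚ) (t : ℕ → ℚ) → (∀ j → g j IntegratesTo t j) →
    ∀ N → (λ x → ∑ N (λ j → g j x)) IntegratesTo ∑ N t
  integ-∑ g t integ zero    = integ-0
  integ-∑ g t integ (suc N) = integ-+ (integ-∑ g t integ N) (integ N)

  ∣x^n∣ : ∀ x n → ∣ x ^ n ∣ ≡ ∣ x ∣ ^ n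
  ∣x^n∣ x zero    = refl
  ∣x^n∣ x (suc n) = trans (ℚ.∣p*q∣≡∣p∣*∣q∣ x (x ^ n)) (cong (∣ x ∣ *_) (∣x^n∣ x n))

  -- This is n + 1 ≤ 2^n. The geometric rate is weakened to a harmonic one so that
  -- `eventually-small` covers both errors.
  ½^n≤mesh : ∀ n → ½ ^ n ≤ mesh n
  ½^n≤mesh n = begin
      ½ ^ n                              ≡⟨ ℚ.*-identityʳ (½ ^ n) ⟨
      ½ ^ n * 1ℚ                         ≡⟨ cong (½ ^ n *_) (fromℕ-inverse (suc n)) ⟨
      ½ ^ n * (fromℕ (suc n) * mesh n)   ≡⟨ solve 3 (λ a b c → a :* (b :* c) := (b :* a) :* c) refl
                                              (½ ^ n) (fromℕ (suc n)) (mesh n) ⟩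
      (fromℕ (suc n) * ½ ^ n) * mesh n
        ≤⟨ ℚ.*-monoʳ-≤-nonNeg (mesh n) {{ℚ.nonNegative (0≤mesh n)}} (linear n) ⟩
      1ℚ * mesh n                        ≡⟨ ℚ.*-identityˡ (mesh n) ⟩
      mesh n                             ∎
    where
    open ℚ.≤-Reasoning
    linear : ∀ n → fromℕ (suc n) * ½ ^ n ≤ 1ℚ
    linear zero    = ℚ.≤-refl
    linear (suc n) = begin
      fromℕ (suc (suc n)) * (½ * ½ ^ n)
        ≤⟨ ℚ.*-monoʳ-≤-nonNeg (½ * ½ ^ n) {{ℚ.nonNegative (^-nonNeg (suc n) (ℚ.nonNegative⁻¹ ½))}}
             (fromℕ-mono (ℕ.s≤s (ℕ.m≤n+m (suc n) n))) ⟩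
      fromℕ (suc n ℕ.+ suc n) * (½ * ½ ^ n)
        ≡⟨ cong (_* (½ * ½ ^ n)) (fromℕ-+ (suc n) (suc n)) ⟩
      (fromℕ (suc n) + fromℕ (suc n)) * (½ * ½ ^ n)
        ≡⟨ solve 2 (λ a b → (a :+ a) :* (con ½ :* b) := a :* b) refl (fromℕ (suc n)) (½ ^ n) ⟩
      fromℕ (suc n) * ½ ^ n
        ≤⟨ linear n ⟩
      1ℚ ∎

-- The logarithm as an integral over [0,1].

module LogIntegral (X : ℚ) .{{_ : Positive X}} where
  open import Data.Rational.Base using (_+_; _*_; _-_; _≤_; _<_; _⊓_; ∣_∣)
  open RiemannLemmas
  open RecipLemmas
  open +-*-Solver

  affine : ℚ → ℚ
  affine x = 1ℚ + x * (X - 1ℚ)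

  slope : ℚ → ℚ
  slope x = (X - 1ℚ) * recip (affine x)

  min≤affine : ∀ x → 0ℚ ≤ x → x ≤ 1ℚ → 1ℚ ⊓ X ≤ affine x
  min≤affine x 0≤x x≤1 = segment-≥-min X (affine x) (x , 0≤x , x≤1 , refl)

  0<min : 0ℚ < 1ℚ ⊓ X
  0<min = min-pos X (ℚ.positive⁻¹ X)

  affine*recip : ∀ x → 0ℚ ≤ x → x ≤ 1ℚ → affine x * recip (affine x) ≡ 1ℚ
  affine*recip x 0≤x x≤1 = *-recip (affine x) (ℚ.<-≤-trans 0<min (min≤affine x 0≤x x≤1))

  slope-bound : ℚ
  slope-bound = ∣ X - 1ℚ ∣ * recip (1ℚ ⊓ X)

  ∣slope∣≤ : ∀ x → 0ℚ ≤ x → x ≤ 1ℚ → ∣ slope x ∣ ≤ slope-bound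
  ∣slope∣≤ x 0≤x x≤1 = begin
      ∣ (X - 1ℚ) * recip (affine x) ∣     ≡⟨ ℚ.∣p*q∣≡∣p∣*∣q∣ (X - 1ℚ) (recip (affine x)) ⟩
      ∣ X - 1ℚ ∣ * ∣ recip (affine x) ∣
        ≡⟨ cong (∣ X - 1ℚ ∣ *_) (ℚ.0≤p⇒∣p∣≡p (recip-nonNeg (affine x)
             (ℚ.<-≤-trans 0<min (min≤affine x 0≤x x≤1)))) ⟩
      ∣ X - 1ℚ ∣ * recip (affine x)
        ≤⟨ ℚ.*-monoˡ-≤-nonNeg ∣ X - 1ℚ ∣ {{ℚ.∣-∣-nonNeg (X - 1ℚ)}}
             (recip-antitone (1ℚ ⊓ X) (affine x) 0<min (min≤affine x 0≤x x≤1)) ⟩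
      ∣ X - 1ℚ ∣ * recip (1ℚ ⊓ X)         ∎
    where open ℚ.≤-Reasoning

  -- The substitution t = `affine x` carries the uniform nodes of [0,1] to those between 1 and X and
  -- scales the step by X - 1. Hence the Riemann sums agree exactly for each n, not merely in the
  -- limit.
  seq-log : ∀ n → seq (log X) n ≡ unitSum slope n
  seq-log n = ∑-cong (suc n) (λ i → trans
    (cong (λ y → recip (1ℚ + y) * ((X - 1ℚ) * mesh n))
      (solve 3 (λ a b c → a :* (b :* c) := a :* c :* b) refl (fromℕ i) (X - 1ℚ) (mesh n)))
    (solve 3 (λ a b c → a :* (b :* c) := b :* a :* c) refl
      (recip (affine (node n i))) (X - 1ℚ) (mesh n)))

-- Summing one series from its factorisation.

module Evaluation
    (P : ℕ → ℤ) (z : ℤ) .{{_ : ℤ.NonZero z}} (ζ : ℚ) (X : ℚ) .{{_ : Positive X}} (c : ℚ)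
    (r₀ r₁ r₂ r₃ : ℚ) (u v : ℚ → ℚ) where
  open ℚ^ using (_^_; ^-assocʳ; ^-distrib-*)
  open import Data.Rational.Base using (_+_; _*_; _-_; -_; _≤_; ∣_∣)
  open RiemannLemmas
  open Beta
  open Moments
  open Convergence
  open LogIntegral X
  open +-*-Solver

  w cubic : ℚ → ℚ
  w x = u x * v x ^ 3
  cubic x = r₀ * v x ^ 3 + r₁ * (u x * v x ^ 2) + r₂ * (u x ^ 2 * v x) + r₃ * u x ^ 3

  module _
      (ζz≡1 : ζ * fromℤ z ≡ 1ℚ)
      (∣ζ∣≤½ : ∣ ζ ∣ ≤ ½)
      (weight≡ : ∀ j → weight r₀ r₁ r₂ r₃ (fromℕ j) ≡
        fromℤ (P (suc j)) * (fromℕ 3 + fromℕ 3 * fromℕ j))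
      (integ-uv : ∀ i j → (λ x → u x ^ i * v x ^ j) IntegratesTo β i j)
      (u-unit : ∀ x → 0ℚ ≤ x → x ≤ 1ℚ → 0ℚ ≤ u x × u x ≤ 1ℚ)
      (v-unit : ∀ x → 0ℚ ≤ x → x ≤ 1ℚ → 0ℚ ≤ v x × v x ≤ 1ℚ)
      (factorisation : ∀ x → ζ * cubic x * affine x ≡ c * (X - 1ℚ) * (1ℚ - ζ * w x))
    where

    integrand : ℕ → ℚ → ℚ
    integrand j x = ζ ^ suc j * (w x ^ j * cubic x)

    integ-term : ∀ j → integrand j IntegratesTo term P z (suc j)
    integ-term j = integ-cong
      (λ x → cong (ζ ^ suc j *_) (expand x))
      (sym (term-moment P z ζ r₀ r₁ r₂ r₃ j ζz≡1 (weight≡ j)))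
      (integ-* (ζ ^ suc j) (integ-+ (integ-+ (integ-+
        (integ-* r₀ (integ-uv j (3 ℕ.+ 3 ℕ.* j)))
        (integ-* r₁ (integ-uv (1 ℕ.+ j) (2 ℕ.+ 3 ℕ.* j))))
        (integ-* r₂ (integ-uv (2 ℕ.+ j) (1 ℕ.+ 3 ℕ.* j))))
        (integ-* r₃ (integ-uv (3 ℕ.+ j) (3 ℕ.* j)))))
      where
      open ≡-Reasoning
      -- The nesting copies how `_^_` unfolds at exponents such as `3 ℕ.+ 3 ℕ.* j`, so that the
      -- integrand assembled from `integ-uv` matches by computation.
      monomials : ℚ → ℚ → ℚ → ℚ → ℚ
      monomials a b p q =
        r₀ * (p * (b * (b * (b * q)))) + r₁ * ((a * p) * (b * (b * q))) +
        r₂ * ((a * (a * p)) * (b * q)) + r₃ * ((a * (a * (a * p))) * q)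
      expand : ∀ x → monomials (u x) (v x) (u x ^ j) (v x ^ (3 ℕ.* j)) ≡ w x ^ j * cubic x
      expand x = sym (begin
        w x ^ j * cubic x
          ≡⟨ cong (_* cubic x) (trans (^-distrib-* (u x) (v x ^ 3) j)
               (cong (u x ^ j *_) (^-assocʳ (v x) 3 j))) ⟩
        u x ^ j * v x ^ (3 ℕ.* j) * cubic x
          ≡⟨ solve 8 (λ r₀ r₁ r₂ r₃ a b p q →
               p :* q :* (r₀ :* b :^ 3 :+ r₁ :* (a :* b :^ 2) :+ r₂ :* (a :^ 2 :* b) :+ r₃ :* a :^ 3) :=
               r₀ :* (p :* (b :* (b :* (b :* q)))) :+ r₁ :* ((a :* p) :* (b :* (b :* q))) :+
               r₂ :* ((a :* (a :* p)) :* (b :* q)) :+ r₃ :* ((a :* (a :* (a :* p))) :* q))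
               refl r₀ r₁ r₂ r₃ (u x) (v x) (u x ^ j) (v x ^ (3 ℕ.* j)) ⟩
        monomials (u x) (v x) (u x ^ j) (v x ^ (3 ℕ.* j)) ∎)

    -- `factorisation` holds for every rational x, but dividing by `affine x` needs x in [0,1],
    -- where it is at least min(1, X) > 0.
    cubic-slope : ∀ x → 0ℚ ≤ x → x ≤ 1ℚ → ζ * cubic x ≡ c * slope x * (1ℚ - ζ * w x)
    cubic-slope x 0≤x x≤1 = begin
        ζ * cubic x
          ≡⟨ ℚ.*-identityʳ (ζ * cubic x) ⟨
        ζ * cubic x * 1ℚ
          ≡⟨ cong (ζ * cubic x *_) (affine*recip x 0≤x x≤1) ⟨
        ζ * cubic x * (affine x * recip (affine x))
          ≡⟨ ℚ.*-assoc (ζ * cubic x) (affine x) (recip (affine x)) ⟨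
        ζ * cubic x * affine x * recip (affine x)
          ≡⟨ cong (_* recip (affine x)) (factorisation x) ⟩
        c * (X - 1ℚ) * (1ℚ - ζ * w x) * recip (affine x)
          ≡⟨ solve 4 (λ a b d e → a :* b :* d :* e := a :* (b :* e) :* d) refl
               c (X - 1ℚ) (1ℚ - ζ * w x) (recip (affine x)) ⟩
        c * slope x * (1ℚ - ζ * w x) ∎
      where open ≡-Reasoning

    -- The progression has ratio ζ w, and `cubic-slope` shows that its first term already contains
    -- the factor 1 - ζ w, so the sum telescopes without dividing by that factor.
    geometric-sum : ∀ x → 0ℚ ≤ x → x ≤ 1ℚ → ∀ N →
      ∑ N (λ j → integrand j x) ≡ c * slope x * (1ℚ - (ζ * w x) ^ N)
    geometric-sum x 0≤x x≤1 zero    =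
      solve 1 (λ a → con 0ℚ := a :* (con 1ℚ :- con 1ℚ)) refl (c * slope x)
    geometric-sum x 0≤x x≤1 (suc N) = begin
        ∑ N (λ j → integrand j x) + ζ * ζ ^ N * (w x ^ N * cubic x)
          ≡⟨ cong₂ _+_ (geometric-sum x 0≤x x≤1 N)
               (solve 4 (λ a b d e → a :* b :* (d :* e) := (b :* d) :* (a :* e)) refl
                 ζ (ζ ^ N) (w x ^ N) (cubic x)) ⟩
        c * slope x * (1ℚ - q ^ N) + (ζ ^ N * w x ^ N) * (ζ * cubic x)
          ≡⟨ cong₂ (λ a b → c * slope x * (1ℚ - q ^ N) + a * b)
               (sym (^-distrib-* ζ (w x) N)) (cubic-slope x 0≤x x≤1) ⟩
        c * slope x * (1ℚ - q ^ N) + q ^ N * (c * slope x * (1ℚ - q))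
          ≡⟨ solve 3 (λ s q p → s :* (con 1ℚ :- p) :+ p :* (s :* (con 1ℚ :- q)) :=
               s :* (con 1ℚ :- q :* p)) refl (c * slope x) q (q ^ N) ⟩
        c * slope x * (1ℚ - q ^ suc N) ∎
      where
      open ≡-Reasoning
      q = ζ * w x

    -- The constant ½ is the size of ζ for z = -2, the slowest of the four series.
    ∣ζw∣≤½ : ∀ x → 0ℚ ≤ x → x ≤ 1ℚ → ∣ ζ * w x ∣ ≤ ½
    ∣ζw∣≤½ x 0≤x x≤1 = begin
        ∣ ζ * w x ∣      ≡⟨ ℚ.∣p*q∣≡∣p∣*∣q∣ ζ (w x) ⟩
        ∣ ζ ∣ * ∣ w x ∣  ≡⟨ cong (∣ ζ ∣ *_) (ℚ.0≤p⇒∣p∣≡p 0≤w) ⟩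
        ∣ ζ ∣ * w x      ≤⟨ *-mono-nonNeg (ℚ.nonNegative⁻¹ ½) 0≤w ∣ζ∣≤½ w≤1 ⟩
        ½ * 1ℚ           ≡⟨ ℚ.*-identityʳ ½ ⟩
        ½                ∎
      where
      open ℚ.≤-Reasoning
      0≤u = proj₁ (u-unit x 0≤x x≤1)
      u≤1 = proj₂ (u-unit x 0≤x x≤1)
      0≤v = proj₁ (v-unit x 0≤x x≤1)
      v≤1 = proj₂ (v-unit x 0≤x x≤1)
      0≤w = *-nonNeg 0≤u (^-nonNeg 3 0≤v)
      w≤1 : w x ≤ 1ℚ
      w≤1 = *-mono-nonNeg 0≤1 (^-nonNeg 3 0≤v) u≤1 (^-mono 3 0≤v v≤1)

    truncation-bound : ∀ N x → 0ℚ ≤ x → x ≤ 1ℚ →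
      ∣ ∑ N (λ j → integrand j x) - c * slope x ∣ ≤ ∣ c ∣ * slope-bound * mesh N
    truncation-bound N x 0≤x x≤1 = begin
        ∣ ∑ N (λ j → integrand j x) - c * slope x ∣
          ≡⟨ cong ∣_∣ (trans (cong (_- c * slope x) (geometric-sum x 0≤x x≤1 N))
               (solve 2 (λ s p → s :* (con 1ℚ :- p) :- s := :- (s :* p)) refl
                 (c * slope x) ((ζ * w x) ^ N))) ⟩
        ∣ - (c * slope x * (ζ * w x) ^ N) ∣
          ≡⟨ ℚ.∣-p∣≡∣p∣ (c * slope x * (ζ * w x) ^ N) ⟩
        ∣ c * slope x * (ζ * w x) ^ N ∣
          ≡⟨ ℚ.∣p*q∣≡∣p∣*∣q∣ (c * slope x) ((ζ * w x) ^ N) ⟩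
        ∣ c * slope x ∣ * ∣ (ζ * w x) ^ N ∣
          ≡⟨ cong₂ _*_ (ℚ.∣p*q∣≡∣p∣*∣q∣ c (slope x)) (∣x^n∣ (ζ * w x) N) ⟩
        ∣ c ∣ * ∣ slope x ∣ * ∣ ζ * w x ∣ ^ N
          ≤⟨ *-mono-nonNeg (ℚ.≤-trans (*-nonNeg (ℚ.0≤∣p∣ c) (ℚ.0≤∣p∣ (slope x))) cs≤)
               (^-nonNeg N (ℚ.0≤∣p∣ (ζ * w x))) cs≤
               (ℚ.≤-trans (^-mono N (ℚ.0≤∣p∣ (ζ * w x)) (∣ζw∣≤½ x 0≤x x≤1)) (½^n≤mesh N)) ⟩
        ∣ c ∣ * slope-bound * mesh N ∎
      where
      open ℚ.≤-Reasoning
      cs≤ : ∣ c ∣ * ∣ slope x ∣ ≤ ∣ c ∣ * slope-bound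
      cs≤ = ℚ.*-monoˡ-≤-nonNeg ∣ c ∣ {{ℚ.∣-∣-nonNeg c}} (∣slope∣≤ x 0≤x x≤1)

    -- S is kept apart from `c · log X` because reals have no quotient here: with c = 1 the sum is
    -- `log X` itself, which agrees with `1ℚ · log X` only termwise.
    series-log : ∀ S → (∀ n → seq S n ≡ c * seq (log X) n) → ∑∞ term P z ≐ S
    series-log S seq-S = converges (term P z) S (∣ c ∣ * slope-bound) (λ N → K N , λ n → begin
        ∣ s N - seq S n ∣
          ≡⟨ cong (λ y → ∣ s N - y ∣) (trans (seq-S n)
               (trans (cong (c *_) (seq-log n)) (sym (unitSum-* c slope n)))) ⟩
        ∣ s N - unitSum (λ x → c * slope x) n ∣
          -- Inserting the Riemann sum of the truncated integrand separates the truncation error,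
          -- small for large N, from the quadrature error, small for large n.
          ≡⟨ cong ∣_∣ (solve 3 (λ a b d → a :- d := (b :- d) :+ (a :- b)) refl (s N)
               (unitSum (g N) n) (unitSum (λ x → c * slope x) n)) ⟩
        ∣ (unitSum (g N) n - unitSum (λ x → c * slope x) n) + (s N - unitSum (g N) n) ∣
          ≤⟨ ℚ.∣p+q∣≤∣p∣+∣q∣ (unitSum (g N) n - unitSum (λ x → c * slope x) n)
               (s N - unitSum (g N) n) ⟩
        ∣ unitSum (g N) n - unitSum (λ x → c * slope x) n ∣ + ∣ s N - unitSum (g N) n ∣
          ≤⟨ ℚ.+-mono-≤
               (unitSum-close (g N) (λ x → c * slope x) (∣ c ∣ * slope-bound * mesh N)
                 (truncation-bound N) n)
               (subst (_≤ K N * mesh n) (CauchyLemmas.∣a-b∣≡∣b-a∣ (unitSum (g N) n) (s N))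
                 (_IntegratesTo_.bound (integ N) n)) ⟩
        ∣ c ∣ * slope-bound * mesh N + K N * mesh n ∎)
      where
      open ℚ.≤-Reasoning
      s : ℕ → ℚ
      s N = ∑ N (λ j → term P z (suc j))
      g : ℕ → ℚ → ℚ
      g N x = ∑ N (λ j → integrand j x)
      integ : ∀ N → g N IntegratesTo s N
      integ = integ-∑ integrand (λ j → term P z (suc j)) integ-term
      K : ℕ → ℚ
      K N = _IntegratesTo_.constant (integ N)

-- Polynomial identities for the four series.

module Cases where
  open ℚ^ using (_^_)
  open import Data.Rational.Base using (_+_; _*_; _-_; -_; _≤_; ∣_∣)
  open RiemannLemmas
  open Beta
  open Moments
  open +-*-Solver

  quadratic : ℕ → ℕ → ℕ → ℕ → ℤ
  quadratic a b c k = + a ℤ.* (+ k) ℤ.^ 2 ℤ.- + b ℤ.* + k ℤ.+ + c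

  fromℤ-quadratic : ∀ a b c j → fromℤ (quadratic a b c (suc j)) ≡
    fromℕ a * (1ℚ + fromℕ j) ^ 2 - fromℕ b * (1ℚ + fromℕ j) + fromℕ c
  fromℤ-quadratic a b c j = trans (fromℤ-+ (+ a ℤ.* k ℤ.^ 2 ℤ.- + b ℤ.* k) (+ c))
    (cong (_+ fromℕ c) (trans (fromℤ-minus (+ a ℤ.* k ℤ.^ 2) (+ b ℤ.* k)) (cong₂ _-_
      (trans (fromℤ-* (+ a) (k ℤ.^ 2)) (cong (fromℕ a *_)
        (trans (fromℤ-^ k 2) (cong (_^ 2) (fromℕ-+ 1 j)))))
      (trans (fromℤ-* (+ b) k) (cong (fromℕ b *_) (fromℕ-+ 1 j))))))
    where k = + suc j

  unit-id : ∀ x → 0ℚ ≤ x → x ≤ 1ℚ → 0ℚ ≤ x × x ≤ 1ℚ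
  unit-id x 0≤x x≤1 = 0≤x , x≤1

  unit-reflect : ∀ x → 0ℚ ≤ x → x ≤ 1ℚ → 0ℚ ≤ 1ℚ - x × 1ℚ - x ≤ 1ℚ
  unit-reflect x 0≤x x≤1 =
    subst (_≤ 1ℚ - x) (ℚ.+-inverseʳ x) (ℚ.+-monoˡ-≤ (- x) x≤1) ,
    subst (1ℚ - x ≤_) (ℚ.+-identityʳ 1ℚ) (ℚ.+-monoʳ-≤ 1ℚ (ℚ.neg-antimono-≤ 0≤x))

  -- Solver syntax for `weight`; like the two definitions after it, it must evaluate to the same
  -- expression as its semantic counterpart.
  :weight : ∀ {m} (r₀ r₁ r₂ r₃ : ℕ) → Polynomial m → Polynomial m
  :weight r₀ r₁ r₂ r₃ j =
    con (fromℕ r₀) :* ((n 3 :+ n 3 :* j) :* (n 2 :+ n 3 :* j) :* (n 1 :+ n 3 :* j)) :+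
    con (fromℕ r₁) :* ((n 1 :+ j) :* (n 2 :+ n 3 :* j) :* (n 1 :+ n 3 :* j)) :+
    con (fromℕ r₂) :* ((n 2 :+ j) :* (n 1 :+ j) :* (n 1 :+ n 3 :* j)) :+
    con (fromℕ r₃) :* ((n 3 :+ j) :* (n 2 :+ j) :* (n 1 :+ j))
    where
    n : ℕ → Polynomial _
    n k = con (fromℕ k)

  :quadratic : ∀ {n} (a b c : ℕ) → Polynomial n → Polynomial n
  :quadratic a b c j =
    con (fromℕ a) :* (con 1ℚ :+ j) :^ 2 :- con (fromℕ b) :* (con 1ℚ :+ j) :+ con (fromℕ c)

  :factorisation : ∀ {n} (ζ X c : ℚ) (r₀ r₁ r₂ r₃ : ℕ) → Polynomial n → Polynomial n →
    Polynomial n → Polynomial n × Polynomial n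
  :factorisation ζ X c r₀ r₁ r₂ r₃ x u v =
    con ζ :* (con (fromℕ r₀) :* v :^ 3 :+ con (fromℕ r₁) :* (u :* v :^ 2) :+
              con (fromℕ r₂) :* (u :^ 2 :* v) :+ con (fromℕ r₃) :* u :^ 3) :*
      (con 1ℚ :+ x :* (con X :- con 1ℚ)) :=
    con c :* (con X :- con 1ℚ) :* (con 1ℚ :- con ζ :* (u :* v :^ 3))

  -- The premise ranges over all rational j, where it is a ring identity. The division by 3 + 3j
  -- that it expresses is exact because every summand of `weight` vanishes at j = -1.
  weight-quadratic : ∀ (r₀ r₁ r₂ r₃ a b c : ℕ) →
    (∀ j → weight (fromℕ r₀) (fromℕ r₁) (fromℕ r₂) (fromℕ r₃) j ≡
      (fromℕ a * (1ℚ + j) ^ 2 - fromℕ b * (1ℚ + j) + fromℕ c) * (fromℕ 3 + fromℕ 3 * j)) →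
    ∀ j → weight (fromℕ r₀) (fromℕ r₁) (fromℕ r₂) (fromℕ r₃) (fromℕ j) ≡
      fromℤ (quadratic a b c (suc j)) * (fromℕ 3 + fromℕ 3 * fromℕ j)
  weight-quadratic r₀ r₁ r₂ r₃ a b c eq j = trans (eq (fromℕ j))
    (cong (_* (fromℕ 3 + fromℕ 3 * fromℕ j)) (sym (fromℤ-quadratic a b c j)))

  -- In each case r₀, …, r₃ are the coefficients of the quotient
  -- c (X - 1)(z - w)/(1 + (X - 1) x) written as a cubic form in u and v.
  series₁ : ∑∞ term (quadratic 77 53 10) (ℤ.- + 2) ≐ ((ℤ.- + 3) / 1) · log (+ 2 / 1)
  series₁ = Evaluation.series-log (quadratic 77 53 10) (ℤ.- + 2) (ℤ.- + 1 / 2) (+ 2 / 1) ((ℤ.- + 3) / 1)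
    (fromℕ 3) (fromℕ 12) (fromℕ 12) (fromℕ 6) (λ x → 1ℚ - x) (λ x → x)
    refl (from-yes (∣ ℤ.- + 1 / 2 ∣ ℚ.≤? ½))
    (weight-quadratic 3 12 12 6 77 53 10
      (solve 1 (λ j → :weight 3 12 12 6 j :=
        :quadratic 77 53 10 j :* (con (fromℕ 3) :+ con (fromℕ 3) :* j)) refl))
    integ-β-reflected unit-reflect unit-id
    (solve 1 (λ x → :factorisation (ℤ.- + 1 / 2) (+ 2 / 1) ((ℤ.- + 3) / 1)
      3 12 12 6 x (con 1ℚ :- x) x) refl)
    (((ℤ.- + 3) / 1) · log (+ 2 / 1)) (λ n → refl)

  -- Exchanging u and v keeps X = 2 and the zero x = -1, but turns z into (-1) · 2³ = -8.
  series₂ : ∑∞ term (quadratic 415 343 62) (ℤ.- + 8) ≐ ((ℤ.- + 3) / 1) · log (+ 2 / 1)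
  series₂ = Evaluation.series-log (quadratic 415 343 62) (ℤ.- + 8) (ℤ.- + 1 / 8) (+ 2 / 1) ((ℤ.- + 3) / 1)
    (fromℕ 24) (fromℕ 51) (fromℕ 42) (fromℕ 12) (λ x → x) (λ x → 1ℚ - x)
    refl (from-yes (∣ ℤ.- + 1 / 8 ∣ ℚ.≤? ½))
    (weight-quadratic 24 51 42 12 415 343 62
      (solve 1 (λ j → :weight 24 51 42 12 j :=
        :quadratic 415 343 62 j :* (con (fromℕ 3) :+ con (fromℕ 3) :* j)) refl))
    integ-β unit-id unit-reflect
    (solve 1 (λ x → :factorisation (ℤ.- + 1 / 8) (+ 2 / 1) ((ℤ.- + 3) / 1)
      24 51 42 12 x x (con 1ℚ :- x)) refl)
    (((ℤ.- + 3) / 1) · log (+ 2 / 1)) (λ n → refl)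

  -- X = 2/3 moves the zero to x = 3, where x (1 - x)³ = 3 · (-2)³ = -24.
  series₃ : ∑∞ term (quadratic 187 131 22) (ℤ.- + 24) ≐ log (+ 2 / 3)
  series₃ = Evaluation.series-log (quadratic 187 131 22) (ℤ.- + 24) (ℤ.- + 1 / 24) (+ 2 / 3) 1ℚ
    (fromℕ 8) (fromℕ 27) (fromℕ 30) (fromℕ 12) (λ x → x) (λ x → 1ℚ - x)
    refl (from-yes (∣ ℤ.- + 1 / 24 ∣ ℚ.≤? ½))
    (weight-quadratic 8 27 30 12 187 131 22
      (solve 1 (λ j → :weight 8 27 30 12 j :=
        :quadratic 187 131 22 j :* (con (fromℕ 3) :+ con (fromℕ 3) :* j)) refl))
    integ-β unit-id unit-reflect
    (solve 1 (λ x → :factorisation (ℤ.- + 1 / 24) (+ 2 / 3) 1ℚ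
      8 27 30 12 x x (con 1ℚ :- x)) refl)
    (log (+ 2 / 3)) (λ n → sym (ℚ.*-identityˡ (seq (log (+ 2 / 3)) n)))

  -- X = 3/4 moves the zero to x = 4, where (1 - x) x³ = (-3) · 4³ = -192.
  series₄ : ∑∞ term (quadratic 1261 989 170) (ℤ.- + 192) ≐ log (+ 3 / 4)
  series₄ = Evaluation.series-log (quadratic 1261 989 170) (ℤ.- + 192) (ℤ.- + 1 / 192) (+ 3 / 4) 1ℚ
    (fromℕ 64) (fromℕ 171) (fromℕ 156) (fromℕ 48) (λ x → 1ℚ - x) (λ x → x)
    refl (from-yes (∣ ℤ.- + 1 / 192 ∣ ℚ.≤? ½))
    (weight-quadratic 64 171 156 48 1261 989 170
      (solve 1 (λ j → :weight 64 171 156 48 j :=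
        :quadratic 1261 989 170 j :* (con (fromℕ 3) :+ con (fromℕ 3) :* j)) refl))
    integ-β-reflected unit-reflect unit-id
    (solve 1 (λ x → :factorisation (ℤ.- + 1 / 192) (+ 3 / 4) 1ℚ
      64 171 156 48 x (con 1ℚ :- x) x) refl)
    (log (+ 3 / 4)) (λ n → sym (ℚ.*-identityˡ (seq (log (+ 3 / 4)) n)))

open import Data.Integer.Base using (_+_; _-_; _*_; _^_; -_)

theorem1p2 : (∑∞ term (λ k → + 77 * (+ k) ^ 2 - + 53 * + k + + 10) (- + 2)
    ≐ ((- + 3) / 1) · log (+ 2 / 1))
    × (∑∞ term (λ k → + 415 * (+ k) ^ 2 - + 343 * + k + + 62) (- + 8)
    ≐ ((- + 3) / 1) · log (+ 2 / 1))
    × (∑∞ term (λ k → + 187 * (+ k) ^ 2 - + 131 * + k + + 22) (- + 24)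
    ≐ log (+ 2 / 3))
    × (∑∞ term (λ k → + 1261 * (+ k) ^ 2 - + 989 * + k + + 170) (- + 192)
    ≐ log (+ 3 / 4))
theorem1p2 = Cases.series₁ , Cases.series₂ , Cases.series₃ , Cases.series₄
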